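{- The target problem TARGET for Broadcast Networks of Register Automata (given a protocol $\mathcal{P}$ and a state $q_f$ of $\mathcal{P}$, decide whether there exist a finite non-empty set of agents $\mathbb{A}$ and an initial run $\gamma_0\to^*\gamma_f$ of $\mathcal{P}$ over $\mathbb{A}$ such that every agent $a\in\mathbb{A}$ satisfies $\mathsf{st}(\gamma_f)(a)=q_f$) is undecidable, even when restricted to protocols with two registers.
   Context: **Protocols.** A protocol with $r$ registers is a tuple $\mathcal{P}=(Q,\mathcal{M},\Delta,q_0)$ with $Q$ a finite set of states, $q_0\in Q$ the initial state, $\mathcal{M}$ a finite set of message types and $\Delta\subseteq Q\times \mathsf{Op}\times Q$ a finite set of transitions, where $\mathsf{Op}=\{\mathbf{br}(m,i),\ \mathbf{rec}(m,i,\alpha) \mid m\in\mathcal{M},\ 1\le i\le r,\ \alpha\in\{*,\downarrow,=,\neq\}\}$ ($\mathbf{br}$: broadcast; $\mathbf{rec}$: reception). **Semantics.** For a finite non-empty set of agents $\mathbb{A}$, a configuration over $\mathbb{A}$ is a function $\gamma:\mathbb{A}\to Q\times\mathbb{N}^r$; $\mathsf{st}(\gamma)(a)$ is the state of $a$ and $\mathsf{data}(\gamma)(a,i)$ the value of its register $i$. It is initial if all agents are in $q_0$ and $\mathsf{data}(\gamma)(a,i)\ne\mathsf{data}(\gamma)(a',i')$ whenever $(a,i)\neq(a',i')$. There is a step $\gamma\to\gamma'$ (both over $\mathbb{A}$) if there are $m\in\mathcal{M}$, $a_0\in\mathbb{A}$, $i\in[1,r]$ such that $(\mathsf{st}(\gamma)(a_0),\mathbf{br}(m,i),\mathsf{st}(\gamma')(a_0))\in\Delta$,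 the registers of $a_0$ are unchanged, and for all $a\ne a_0$, either $\gamma'(a)=\gamma(a)$, or there is $(\mathsf{st}(\gamma)(a),\mathbf{rec}(m,j,\alpha),\mathsf{st}(\gamma')(a))\in\Delta$ such that registers $j'\ne j$ of $a$ are unchanged and, with $v=\mathsf{data}(\gamma)(a_0,i)$: if $\alpha=*$, register $j$ of $a$ is unchanged; if $\alpha=\downarrow$, $\mathsf{data}(\gamma')(a,j)=v$; if $\alpha$ is $=$, $\mathsf{data}(\gamma')(a,j)=\mathsf{data}(\gamma)(a,j)=v$; if $\alpha$ is $\neq$, $\mathsf{data}(\gamma')(a,j)=\mathsf{data}(\gamma)(a,j)\neq v$. A run over $\mathbb{A}$ is a finite sequence of steps; it is initial if its first configuration is initial. -}

module Defs where

open import Data.Fin using (Fin; toℕ)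
open import Data.List using (List; []; _∷_; foldr)
open import Data.List.Membership.Propositional using (_∈_)
open import Data.Nat using (ℕ; zero; suc; _+_; _<_)
open import Data.Product using (Σ; ∃; ∃-syntax; _×_; _,_; proj₁; proj₂)
open import Data.Sum using (_⊎_)
open import Data.Vec using (Vec; []; _∷_; lookup)
open import Data.Vec.Relation.Binary.Pointwise.Inductive using (Pointwise)
open import Relation.Binary.Construct.Closure.ReflexiveTransitive using (Star)
open import Relation.Binary.PropositionalEquality using (_≡_; _≢_)
open import Relation.Nullary using (¬_)

------------------------------------------------------------------------
-- Broadcast networks of register automata

data Test : Set where
  ∗ ↓ == ≠ : Test

-- Effect α v old new : receiving the value v with test α may turn the content
-- of the register concerned from old into new.
Effect : Test → ℕ → ℕ → ℕ → Set
Effect ∗  v old new = new ≡ old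
Effect ↓  v old new = new ≡ v
Effect == v old new = new ≡ old × old ≡ v
Effect ≠  v old new = new ≡ old × old ≢ v

data Op (M : Set) (r : ℕ) : Set where
  br  : (m : M) (i : Fin r) → Op M r
  rec : (m : M) (i : Fin r) (α : Test) → Op M r

-- Protocols are inputs of an algorithm, so their finite sets of states and
-- of message types are initial segments of ℕ, and Δ is given by enumeration.
record Protocol (r : ℕ) : Set where
  field
    #states   : ℕ
    #messages : ℕ

  State   = Fin #states
  Message = Fin #messages

  field
    Δ  : List (State × Op Message r × State)
    q₀ : State

module Semantics {r : ℕ} (P : Protocol r) where
  open Protocol P

  Local : Set
  Local = State × Vec ℕ r

  -- The relation between the local configurations l and l′ of an agent that
  -- receives a message of type m carrying the value v.
  record Reception (m : Message) (v : ℕ) (l l′ : Local) : Set where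
    field
      j          : Fin r
      α          : Test
      transition : (proj₁ l , rec m j α , proj₁ l′) ∈ Δ
      others     : ∀ j′ → j′ ≢ j → lookup (proj₂ l′) j′ ≡ lookup (proj₂ l) j′
      effect     : Effect α v (lookup (proj₂ l) j) (lookup (proj₂ l′) j)

  module _ (𝔸 : Set) where

    Config : Set
    Config = 𝔸 → Local

    st : Config → 𝔸 → State
    st γ a = proj₁ (γ a)

    reg : Config → 𝔸 → Fin r → ℕ
    reg γ a i = lookup (proj₂ (γ a)) i

    record Initial (γ : Config) : Set where
      field
        state    : ∀ a → st γ a ≡ q₀
        distinct : ∀ a i a′ i′ → (a , i) ≢ (a′ , i′) → reg γ a i ≢ reg γ a′ i′

    record Step (γ γ′ : Config) : Set where
      field
        m          : Message
        a₀         : 𝔸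
        i          : Fin r
        transition : (st γ a₀ , br m i , st γ′ a₀) ∈ Δ
        unchanged  : ∀ j → reg γ′ a₀ j ≡ reg γ a₀ j
        others     : ∀ a → a ≢ a₀ →
                     γ′ a ≡ γ a ⊎ Reception m (reg γ a₀ i) (γ a) (γ′ a)

    Run : Config → Config → Set
    Run = Star Step

Instance : ℕ → Set
Instance r = Σ (Protocol r) Protocol.State

-- The finite non-empty sets of agents are, up to renaming, the Fin (suc n).
Target : ∀ {r} → Instance r → Set
Target (P , qf) =
  ∃[ n ] let open Semantics P; 𝔸 = Fin (suc n) in
  ∃[ γ₀ ] ∃[ γf ] Initial 𝔸 γ₀ × Run 𝔸 γ₀ γf × (∀ a → st 𝔸 γf a ≡ qf)

------------------------------------------------------------------------
-- Partial recursive functions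

data Rec : ℕ → Set where
  zer  : Rec 0
  succ : Rec 1
  proj : ∀ {n} → Fin n → Rec n
  comp : ∀ {m n} → Rec m → Vec (Rec n) m → Rec n
  prec : ∀ {n} → Rec n → Rec (suc (suc n)) → Rec (suc n)
  mini : ∀ {n} → Rec (suc n) → Rec n

infix 4 _[_]⇓_

-- f [ xs ]⇓ y : f is defined at xs, with value y.
data _[_]⇓_ : ∀ {n} → Rec n → Vec ℕ n → ℕ → Set where
  zer⇓  : zer [ [] ]⇓ 0
  succ⇓ : ∀ {x} → succ [ x ∷ [] ]⇓ suc x
  proj⇓ : ∀ {n} {i : Fin n} {xs} → proj i [ xs ]⇓ lookup xs i
  comp⇓ : ∀ {m n} {f : Rec m} {gs : Vec (Rec n) m} {xs ys z} →
          Pointwise (λ g y → g [ xs ]⇓ y) gs ys → f [ ys ]⇓ z →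
          comp f gs [ xs ]⇓ z
  base⇓ : ∀ {n} {f : Rec n} {g xs y} →
          f [ xs ]⇓ y → prec f g [ zero ∷ xs ]⇓ y
  step⇓ : ∀ {n} {f : Rec n} {g k xs y z} →
          prec f g [ k ∷ xs ]⇓ y → g [ k ∷ y ∷ xs ]⇓ z →
          prec f g [ suc k ∷ xs ]⇓ z
  mini⇓ : ∀ {n} {f : Rec (suc n)} {xs y} →
          (∀ {k} → k < y → ∃[ z ] f [ k ∷ xs ]⇓ suc z) →
          f [ y ∷ xs ]⇓ 0 → mini f [ xs ]⇓ y

-- f computes the characteristic function of P on codes of elements of A; its
-- behaviour on numbers that are not codes is unconstrained.
record Decides {A : Set} (code : A → ℕ) (P : A → Set) (f : Rec 1) : Set where
  field
    accepts : ∀ x → P x → f [ code x ∷ [] ]⇓ 1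
    rejects : ∀ x → ¬ P x → f [ code x ∷ [] ]⇓ 0

Undecidable : {A : Set} → (A → ℕ) → (A → Set) → Set
Undecidable code P = ¬ (∃[ f ] Decides code P f)

------------------------------------------------------------------------
-- Gödel numbering of instances

triangle : ℕ → ℕ
triangle zero    = 0
triangle (suc n) = suc n + triangle n

-- Cantor's pairing bijection ℕ × ℕ → ℕ.
⟨_,_⟩ : ℕ → ℕ → ℕ
⟨ x , y ⟩ = triangle (x + y) + y

codeList : {A : Set} → (A → ℕ) → List A → ℕ
codeList code = foldr (λ x n → suc ⟨ code x , n ⟩) 0

codeTest : Test → ℕ
codeTest ∗  = 0
codeTest ↓  = 1
codeTest == = 2
codeTest ≠  = 3

codeOp : ∀ {m r} → Op (Fin m) r → ℕ
codeOp (br m i)    = ⟨ 0 , ⟨ toℕ m , toℕ i ⟩ ⟩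
codeOp (rec m i α) = ⟨ suc (codeTest α) , ⟨ toℕ m , toℕ i ⟩ ⟩

codeTransition : ∀ {n m r} → Fin n × Op (Fin m) r × Fin n → ℕ
codeTransition (q , o , q′) = ⟨ toℕ q , ⟨ codeOp o , toℕ q′ ⟩ ⟩

code : ∀ {r} → Instance r → ℕ
code {r} (P , qf) =
  ⟨ r , ⟨ #states , ⟨ #messages , ⟨ codeList codeTransition Δ , ⟨ toℕ q₀ , toℕ qf ⟩ ⟩ ⟩ ⟩ ⟩
  where open Protocol P

-- Given a partial recursive f that decides TARGET, a counter program computes
-- the code of a protocol that runs this very program, applies f to it, halts
-- if the value is 0, and gets stuck otherwise. If the program halts exactly
-- when TARGET holds of the protocol, f is wrong about it. For the contradiction
-- it suffices that programs are simulated forwards, and are deterministic.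
--
-- In the protocol, register 0 of an agent keeps its identity, and register 1
-- stores the identity of its predecessor, the agent whose init message it has
-- accepted. From then on it only reads messages of its predecessor. A run that
-- reaches the target is meant to be a ring made of one root, which executes the
-- program, and of cells, each of which is blank or holds one unit of one
-- counter. The root sends a request into the row of cells, which is served by
-- the first suitable cell, and waits for the reply.
--
-- Messages can be lost, and several roots can coexist. But an agent that has
-- reached the target has sent as many letters as it has received, and has
-- received a subword of what its predecessor sent. So no letter is lost between
-- an agent that has sent a longest word and its predecessor, and the same holds
-- of the predecessor. Chains of predecessors lead to roots. Each root among
-- these agents therefore gets its replies from an intact row of blank cells
-- that is fed by another such root, and by induction on time all of them execute
-- the same computation.
--
-- The program gets its own code e from a loader, a chain of e transitions that
-- increment register 0. As e is the code of the remaining transitions, the code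
-- of the whole protocol is a primitive recursive function of e.
module Submission where

open import Data.Empty using (⊥)
open import Data.Fin as Fin using (Fin; zero; suc; toℕ; fromℕ<)
open import Data.Fin.Properties using (toℕ<n; toℕ-fromℕ<; toℕ-injective)
open import Data.List using (List; []; _∷_; _++_; length; map; concatMap; foldr; replicate)
open import Data.List.Membership.Propositional using (_∈_)
open import Data.List.Membership.Propositional.Properties
  using (∈-++⁺ˡ; ∈-++⁺ʳ; ∈-map⁺; ∈-map⁻)
open import Data.List.Properties using (length-replicate)
open import Data.List.Relation.Unary.All as All using (All; []; _∷_)
import Data.List.Relation.Unary.All.Properties as All
open import Data.List.Relation.Unary.Any using (here; there)
open import Data.List.Relation.Binary.Sublist.Propositional
  using (_⊆_; _∷_; _∷ʳ_; minimum; ⊆-refl; ⊆-trans)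
open import Data.List.Relation.Binary.Sublist.Heterogeneous.Properties
  using (length-mono-≤; toPointwise)
open import Data.List.Relation.Binary.Pointwise using (Pointwise-≡⇒≡)
open import Data.Maybe as Maybe using (Maybe; just; nothing; maybe′)
open import Data.Maybe.Properties using (just-injective)
open import Data.Nat
open import Data.Nat.Properties
open import Data.Product using (Σ; ∃; ∃-syntax; _×_; _,_; proj₁; proj₂; map₂)
open import Data.Sum using (_⊎_; inj₁; inj₂)
open import Data.Vec using (Vec; []; _∷_; lookup)
open import Data.Vec.Relation.Binary.Pointwise.Inductive using (Pointwise; []; _∷_)
open import Function using (_∘_; id)
open import Relation.Binary.Construct.Closure.ReflexiveTransitive using (Star; ε; _◅_; _◅◅_; gmap)
open import Relation.Binary.Definitions using (tri<; tri≈; tri>)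
open import Relation.Binary.PropositionalEquality
open import Relation.Nullary using (¬_; Dec; yes; no; contradiction)
open import Defs

-- Codes

≤-triangle : ∀ n → n ≤ triangle n
≤-triangle zero    = z≤n
≤-triangle (suc n) = m≤m+n (suc n) (triangle n)

triangle-mono : ∀ {m n} → m ≤ n → triangle m ≤ triangle n
triangle-mono z≤n       = z≤n
triangle-mono (s≤s m≤n) = +-mono-≤ (s≤s m≤n) (triangle-mono m≤n)

-- Cantor's numbering gives the diagonal with sum `s` the interval that starts at `triangle s` and
-- has length `suc s`. These intervals are disjoint, so a pair can be recovered first by its sum and
-- then by its offset.
triangle-gap : ∀ {s t y} z → y ≤ s → s < t → triangle s + y < triangle t + z
triangle-gap {s} {t} {y} z y≤s s<t = begin-strict
  triangle s + y      <⟨ +-monoʳ-< (triangle s) (s≤s y≤s) ⟩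
  triangle s + suc s  ≡⟨ +-comm (triangle s) (suc s) ⟩
  triangle (suc s)    ≤⟨ triangle-mono s<t ⟩
  triangle t          ≤⟨ m≤m+n _ z ⟩
  triangle t + z      ∎
  where open ≤-Reasoning

-- Opaque, so that triangle does not unfold at literal arguments.
opaque

  pair : ℕ → ℕ → ℕ
  pair = ⟨_,_⟩

  pair-def : ∀ x y → ⟨ x , y ⟩ ≡ pair x y
  pair-def x y = refl

  pair-≥ˡ : ∀ x y → x ≤ pair x y
  pair-≥ˡ x y = ≤-trans (m≤m+n x y) (≤-trans (≤-triangle (x + y)) (m≤m+n _ y))

  pair-≥ʳ : ∀ x y → y ≤ pair x y
  pair-≥ʳ x y = m≤n+m y _

  pair-injective : ∀ x y x′ y′ → pair x y ≡ pair x′ y′ → x ≡ x′ × y ≡ y′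
  pair-injective x y x′ y′ eq with <-cmp (x + y) (x′ + y′)
  ... | tri< lt _ _ = contradiction eq (<⇒≢ (triangle-gap y′ (m≤n+m y x) lt))
  ... | tri> _ _ gt = contradiction (sym eq) (<⇒≢ (triangle-gap y (m≤n+m y′ x′) gt))
  ... | tri≈ _ s≡ _ = +-cancelʳ-≡ y x x′ (trans s≡ (cong (x′ +_) (sym y≡))) , y≡
    where
    y≡ : y ≡ y′
    y≡ = +-cancelˡ-≡ (triangle (x + y)) y y′
           (trans eq (cong (λ s → triangle s + y′) (sym s≡)))

infixr 5 _·_

-- A common target for programs, states, letters and messages: injectivity of the numbering is
-- proved once for trees, and each type then only needs a left inverse of its embedding.
data Tree : Set where
  leaf : ℕ → Tree
  _·_  : Tree → Tree → Tree

codeTree : Tree → ℕ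
codeTree (leaf n) = pair 0 n
codeTree (s · t)  = pair 1 (pair (codeTree s) (codeTree t))

codeTree-injective : ∀ s t → codeTree s ≡ codeTree t → s ≡ t
codeTree-injective (leaf m) (leaf n) eq = cong leaf (proj₂ (pair-injective 0 m 0 n eq))
codeTree-injective (leaf m) (s · t)  eq
  with () ← proj₁ (pair-injective 0 m 1 (pair (codeTree s) (codeTree t)) eq)
codeTree-injective (s · t)  (leaf n) eq
  with () ← proj₁ (pair-injective 1 (pair (codeTree s) (codeTree t)) 0 n eq)
codeTree-injective (s · t) (s′ · t′) eq =
  let _ , eq′   = pair-injective 1 (pair (codeTree s) (codeTree t)) 1 (pair (codeTree s′) (codeTree t′)) eq
      s≡s′ , t≡t′ = pair-injective (codeTree s) (codeTree t) (codeTree s′) (codeTree t′) eq′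
  in cong₂ _·_ (codeTree-injective s s′ s≡s′) (codeTree-injective t t′ t≡t′)

-- Counter programs

infixr 5 _▷_

-- Each instruction carries the rest of the program, so the remaining program itself serves as the
-- control point and no labels are needed. `loop r b p` decrements `r` before each round of `b` and
-- continues with `p` once `r` is zero. Both `end` and `stuck` stop, but only `end` counts as
-- halting.
data Prog : Set where
  end stuck : Prog
  inc       : (r : ℕ) → Prog → Prog
  loop      : (r : ℕ) → Prog → Prog → Prog

_▷_ : Prog → Prog → Prog
end        ▷ q = q
stuck      ▷ q = stuck
inc r p    ▷ q = inc r (p ▷ q)
loop r b p ▷ q = loop r b (p ▷ q)

▷-assoc : ∀ p q k → (p ▷ q) ▷ k ≡ p ▷ q ▷ k
▷-assoc end          q k = refl
▷-assoc stuck        q k = refl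
▷-assoc (inc r p)    q k = cong (inc r) (▷-assoc p q k)
▷-assoc (loop r b p) q k = cong (loop r b) (▷-assoc p q k)

-- Generic in the control points `C`, which are programs here and, in the roots of the network,
-- programs preceded by a loader.
data Instr (C : Set) : Set where
  incr : (r : ℕ) (c : C) → Instr C
  decr : (r : ℕ) (c c₀ : C) → Instr C

progInstr : Prog → Maybe (Instr Prog)
progInstr end          = nothing
progInstr stuck        = nothing
progInstr (inc r p)    = just (incr r p)
progInstr (loop r b p) = just (decr r (b ▷ loop r b p) p)

Store : Set
Store = ℕ → ℕ

-- The stores are related pointwise, since functions are not extensional.
data Move {C : Set} (instr : C → Maybe (Instr C)) : C × Store → C × Store → Set where
  incr : ∀ {c c′ σ τ r} → instr c ≡ just (incr r c′) →
         τ r ≡ suc (σ r) → (∀ q → q ≢ r → τ q ≡ σ q) → Move instr (c , σ) (c′ , τ)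
  decr : ∀ {c c′ c₀ σ τ r} → instr c ≡ just (decr r c′ c₀) →
         σ r ≡ suc (τ r) → (∀ q → q ≢ r → τ q ≡ σ q) → Move instr (c , σ) (c′ , τ)
  none : ∀ {c c′ c₀ σ τ r} → instr c ≡ just (decr r c′ c₀) →
         σ r ≡ 0 → (∀ q → τ q ≡ σ q) → Move instr (c , σ) (c₀ , τ)

module _ {C : Set} {instr : C → Maybe (Instr C)} where

  move-deterministic : ∀ {c c₁ c₂ σ σ′ τ₁ τ₂} → (∀ q → σ q ≡ σ′ q) →
                       Move instr (c , σ) (c₁ , τ₁) → Move instr (c , σ′) (c₂ , τ₂) →
                       c₁ ≡ c₂ × (∀ q → τ₁ q ≡ τ₂ q)
  move-deterministic {c} {σ = σ} {σ′} {τ₁} {τ₂} σ≗ (incr {r = r} i τr τq) (incr i′ τr′ τq′)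
    with refl ← trans (sym i) i′ = refl , λ q → at q (q ≟ r)
    where
    at : ∀ q → Dec (q ≡ r) → τ₁ q ≡ τ₂ q
    at q (yes refl) = trans τr (trans (cong suc (σ≗ r)) (sym τr′))
    at q (no q≢r)   = trans (τq q q≢r) (trans (σ≗ q) (sym (τq′ q q≢r)))
  move-deterministic {c} {σ = σ} {σ′} {τ₁} {τ₂} σ≗ (decr {r = r} i τr τq) (decr i′ τr′ τq′)
    with refl ← trans (sym i) i′ = refl , λ q → at q (q ≟ r)
    where
    at : ∀ q → Dec (q ≡ r) → τ₁ q ≡ τ₂ q
    at q (yes refl) = suc-injective (trans (sym τr) (trans (σ≗ r) τr′))
    at q (no q≢r)   = trans (τq q q≢r) (trans (σ≗ q) (sym (τq′ q q≢r)))
  move-deterministic σ≗ (none i σr τq) (none i′ σr′ τq′)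
    with refl ← trans (sym i) i′ =
    refl , λ q → trans (τq q) (trans (σ≗ q) (sym (τq′ q)))
  move-deterministic σ≗ (incr i _ _) (decr i′ _ _) with () ← trans (sym i) i′
  move-deterministic σ≗ (incr i _ _) (none i′ _ _) with () ← trans (sym i) i′
  move-deterministic σ≗ (decr i _ _) (incr i′ _ _) with () ← trans (sym i) i′
  move-deterministic σ≗ (none i _ _) (incr i′ _ _) with () ← trans (sym i) i′
  move-deterministic σ≗ (decr i σr _) (none i′ σ′r _) with refl ← trans (sym i) i′
    with () ← trans (sym σr) (trans (σ≗ _) σ′r)
  move-deterministic σ≗ (none i σr _) (decr i′ σ′r _) with refl ← trans (sym i) i′
    with () ← trans (sym σ′r) (trans (sym (σ≗ _)) σr)

  terminal : ∀ {c σ cσ} → instr c ≡ nothing → ¬ Move instr (c , σ) cσ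
  terminal stop (incr i _ _) with () ← trans (sym stop) i
  terminal stop (decr i _ _) with () ← trans (sym stop) i
  terminal stop (none i _ _) with () ← trans (sym stop) i

  run-deterministic : ∀ {c c₁ c₂ σ σ′ τ₁ τ₂} → (∀ q → σ q ≡ σ′ q) →
                      instr c₁ ≡ nothing → instr c₂ ≡ nothing →
                      Star (Move instr) (c , σ) (c₁ , τ₁) →
                      Star (Move instr) (c , σ′) (c₂ , τ₂) → c₁ ≡ c₂
  run-deterministic σ≗ stop₁ stop₂ ε        ε        = refl
  run-deterministic σ≗ stop₁ stop₂ ε        (m ◅ _)  = contradiction m (terminal stop₁)
  run-deterministic σ≗ stop₁ stop₂ (m ◅ _)  ε        = contradiction m (terminal stop₂)
  run-deterministic σ≗ stop₁ stop₂ (m ◅ ms) (n ◅ ns)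
    with refl , τ≗ ← move-deterministic σ≗ m n = run-deterministic τ≗ stop₁ stop₂ ms ns

infixl 6 _[_≔_]

_[_≔_] : Store → ℕ → ℕ → Store
(σ [ r ≔ v ]) q with q ≟ r
... | yes _ = v
... | no  _ = σ q

≔-same : ∀ σ r v → (σ [ r ≔ v ]) r ≡ v
≔-same σ r v with r ≟ r
... | yes _   = refl
... | no  r≢r = contradiction refl r≢r

≔-other : ∀ σ r v q → q ≢ r → (σ [ r ≔ v ]) q ≡ σ q
≔-other σ r v q q≢r with q ≟ r
... | yes q≡r = contradiction q≡r q≢r
... | no  _   = refl

count : ℕ → List ℕ → ℕ
count q [] = 0
count q (t ∷ ts) with q ≟ t
... | yes _ = suc (count q ts)
... | no  _ = count q ts

count-same : ∀ q ts → count q (q ∷ ts) ≡ suc (count q ts)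
count-same q ts with q ≟ q
... | yes _   = refl
... | no  q≢q = contradiction refl q≢q

count-other : ∀ {q t} ts → q ≢ t → count q (t ∷ ts) ≡ count q ts
count-other {q} {t} ts q≢t with q ≟ t
... | yes q≡t = contradiction q≡t q≢t
... | no  _   = refl

-- Total correctness of program fragments

infix 4 _∶_⇝_

-- The quantification over the continuation `k` lets fragments be chained by `▷` and lets the body
-- of a loop return to the loop.
_∶_⇝_ : Prog → Store → Store → Set
p ∶ σ ⇝ τ = ∀ k → Star (Move progInstr) (p ▷ k , σ) (k , τ)

Ends : Prog → Store → (Store → Set) → Set
Ends p σ Q = ∃[ τ ] (p ∶ σ ⇝ τ) × Q τ

infixr 2 _then_

_then_ : ∀ {p q σ Q R} → Ends p σ Q → (∀ τ → Q τ → Ends q τ R) → Ends (p ▷ q) σ R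
_then_ {p} {q} {σ} (τ , ps , Qτ) next with υ , qs , Rυ ← next τ Qτ =
  υ , (λ k → subst (λ r → Star (Move progInstr) (r , σ) (k , υ)) (sym (▷-assoc p q k))
               (ps (q ▷ k) ◅◅ qs k)) , Rυ

weaken : ∀ {p σ Q R} → Ends p σ Q → (∀ {τ} → Q τ → R τ) → Ends p σ R
weaken (τ , ps , Qτ) f = τ , ps , f Qτ

end-ends : ∀ {σ} {Q : Store → Set} → Q σ → Ends end σ Q
end-ends {σ} Qσ = σ , (λ k → ε) , Qσ

inc-ends : ∀ {r p σ Q} → Ends p (σ [ r ≔ suc (σ r) ]) Q → Ends (inc r p) σ Q
inc-ends {r} {p} {σ} (τ , ps , Qτ) =
  τ , (λ k → incr refl (≔-same σ r _) (≔-other σ r _) ◅ ps k) , Qτ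

loop-exit : ∀ {r b p σ} k → σ r ≡ 0 →
            Star (Move progInstr) (loop r b p ▷ k , σ) (p ▷ k , σ)
loop-exit k σr = none refl σr (λ _ → refl) ◅ ε

loop-enter : ∀ {r b p σ n Q} → σ r ≡ suc n → Ends b (σ [ r ≔ n ]) Q →
             ∃[ τ ] (∀ k → Star (Move progInstr) (loop r b p ▷ k , σ) (loop r b p ▷ k , τ)) × Q τ
loop-enter {r} {σ = σ} σr (τ , bs , Qτ) =
  τ , (λ k → decr refl (trans σr (cong suc (sym (≔-same σ r _)))) (≔-other σ r _) ◅ bs _) , Qτ

Sets : Store → ℕ → ℕ → Store → Set
Sets σ r v τ = τ r ≡ v × (∀ q → q ≢ r → τ q ≡ σ q)

incs : List ℕ → Prog
incs = foldr inc end

incs-ends : ∀ ts σ → Ends (incs ts) σ (λ τ → ∀ q → τ q ≡ count q ts + σ q)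
incs-ends []       σ = end-ends (λ q → refl)
incs-ends (t ∷ ts) σ = inc-ends (weaken (incs-ends ts (σ [ t ≔ suc (σ t) ])) λ {τ} → after τ)
  where
  after : ∀ τ → (∀ q → τ q ≡ count q ts + (σ [ t ≔ suc (σ t) ]) q) →
          ∀ q → τ q ≡ count q (t ∷ ts) + σ q
  after τ eq q with q ≟ t | eq q
  ... | yes refl | e = trans e (+-suc (count q ts) (σ q))
  ... | no  _    | e = e

-- The one arithmetic loop from which the others are built: no target clears `r`, one target moves
-- it, two targets duplicate it.
transfer : ℕ → List ℕ → Prog
transfer r ts = loop r (incs ts) end

transfer-ends : ∀ r ts σ → count r ts ≡ 0 →
                Ends (transfer r ts) σ
                  (λ τ → τ r ≡ 0 × (∀ q → q ≢ r → τ q ≡ σ r * count q ts + σ q))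
transfer-ends r ts σ r∉ts = go (σ r) σ refl
  where
  go : ∀ n σ → σ r ≡ n →
       Ends (transfer r ts) σ (λ τ → τ r ≡ 0 × (∀ q → q ≢ r → τ q ≡ n * count q ts + σ q))
  go zero    σ σr = σ , (λ k → loop-exit k σr) , σr , λ q _ → refl
  go (suc n) σ σr
    with τ , ls , eq ← loop-enter {p = end} σr (incs-ends ts (σ [ r ≔ n ]))
    with υ , ls′ , υr , eq′ ← go n τ (trans (eq r) (cong₂ _+_ r∉ts (≔-same σ r n))) =
    υ , (λ k → ls k ◅◅ ls′ k) , υr , λ q q≢r → begin
      υ q                                        ≡⟨ eq′ q q≢r ⟩
      n * count q ts + τ q                       ≡⟨ cong (n * count q ts +_) (eq q) ⟩
      n * count q ts + (count q ts + (σ [ r ≔ n ]) q)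
        ≡⟨ cong (λ s → n * count q ts + (count q ts + s)) (≔-other σ r n q q≢r) ⟩
      n * count q ts + (count q ts + σ q)        ≡⟨ +-assoc (n * count q ts) _ _ ⟨
      n * count q ts + count q ts + σ q          ≡⟨ cong (_+ σ q) (+-comm (n * count q ts) _) ⟩
      count q ts + n * count q ts + σ q          ∎
    where open ≡-Reasoning

clear : ℕ → Prog
clear r = transfer r []

clear-ends : ∀ r σ → Ends (clear r) σ (Sets σ r 0)
clear-ends r σ = weaken (transfer-ends r [] σ refl)
  λ (τr , τq) → τr , λ q q≢r → trans (τq q q≢r) (cong (_+ σ q) (*-zeroʳ (σ r)))

move-ends : ∀ r t σ → t ≢ r → σ t ≡ 0 →
            Ends (transfer r (t ∷ [])) σ
              (λ τ → τ r ≡ 0 × τ t ≡ σ r × (∀ q → q ≢ r → q ≢ t → τ q ≡ σ q))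
move-ends r t σ t≢r σt =
  weaken (transfer-ends r (t ∷ []) σ (count-other [] (t≢r ∘ sym)))
    λ {τ} (τr , τq) →
      τr ,
      (begin
        τ t                              ≡⟨ τq t t≢r ⟩
        σ r * count t (t ∷ []) + σ t     ≡⟨ cong₂ (λ c s → σ r * c + s) (count-same t []) σt ⟩
        σ r * 1 + 0                      ≡⟨ +-identityʳ _ ⟩
        σ r * 1                          ≡⟨ *-identityʳ (σ r) ⟩
        σ r                              ∎) ,
      λ q q≢r q≢t → trans (τq q q≢r)
        (cong (_+ σ q) (trans (cong (σ r *_) (count-other [] q≢t)) (*-zeroʳ (σ r))))
  where open ≡-Reasoning

-- Reading a counter destroys it, so the content goes to both `t` and `z`, and `r` is restored from
-- `z`.
copy : ℕ → ℕ → ℕ → Prog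
copy r t z = transfer r (t ∷ z ∷ []) ▷ transfer z (r ∷ [])

copy-ends : ∀ r t z σ → t ≢ r → z ≢ r → z ≢ t → σ t ≡ 0 → σ z ≡ 0 →
            Ends (copy r t z) σ (Sets σ t (σ r))
copy-ends r t z σ t≢r z≢r z≢t σt σz =
  transfer-ends r (t ∷ z ∷ []) σ
    (trans (count-other (z ∷ []) (t≢r ∘ sym)) (count-other [] (z≢r ∘ sym)))
  then λ τ (τr , τq) →
  let τz : τ z ≡ σ r
      τz = trans (τq z z≢r) (trans
             (cong₂ (λ c s → σ r * c + s)
               (trans (count-other (z ∷ []) z≢t) (count-same z [])) σz)
             (trans (+-identityʳ _) (*-identityʳ (σ r))))
      τt : τ t ≡ σ r
      τt = trans (τq t t≢r) (trans
             (cong₂ (λ c s → σ r * c + s)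
               (trans (count-same t (z ∷ [])) (cong suc (count-other [] (z≢t ∘ sym)))) σt)
             (trans (+-identityʳ _) (*-identityʳ (σ r))))
  in weaken (move-ends z r τ (z≢r ∘ sym) τr) λ {υ} (υz , υr , υq) →
     trans (υq t (z≢t ∘ sym) t≢r) τt , λ q q≢t → others τ υ q q≢t τq υz (trans υr τz) υq
  where
  others : ∀ (τ υ : Store) q → q ≢ t →
           (∀ q → q ≢ r → τ q ≡ σ r * count q (t ∷ z ∷ []) + σ q) →
           υ z ≡ 0 → υ r ≡ σ r → (∀ q → q ≢ z → q ≢ r → υ q ≡ τ q) → υ q ≡ σ q
  others τ υ q q≢t τq υz υr υq with q ≟ z | q ≟ r
  ... | yes refl | _        = trans υz (sym σz)
  ... | no _     | yes refl = υr
  ... | no q≢z   | no q≢r   = trans (υq q q≢z q≢r) (trans (τq q q≢r)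
    (cong (_+ σ q) (trans (cong (σ r *_) (trans (count-other (z ∷ []) q≢t) (count-other [] q≢z)))
                          (*-zeroʳ (σ r)))))

-- Compilation of partial recursive functions

infixr 5 _▸_

_▸_ : ∀ {n} → ℕ → (Fin n → ℕ) → Fin (suc n) → ℕ
(r ▸ ins) zero    = r
(r ▸ ins) (suc i) = ins i

clearAll : ℕ → ℕ → Prog
clearAll o zero    = end
clearAll o (suc m) = clear o ▷ clearAll (suc o) m

-- The program for f reads its arguments from the registers ins and writes its
-- value into out; the registers from free onwards are scratch, and are zero
-- before and after.
mutual

  compile : ∀ {n} → Rec n → (ins : Fin n → ℕ) (out free : ℕ) → Prog
  compile zer               ins out free = end
  compile succ              ins out free = copy (ins zero) out free ▷ inc out end
  compile (proj i)          ins out free = copy (ins i) out free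
  compile (comp {m} f gs)   ins out free =
    compileAll gs ins free (free + m) ▷
    compile f (λ j → free + toℕ j) out (free + m) ▷ clearAll free m
  compile (prec f g)        ins out free =
    copy (ins zero) free (3 + free) ▷
    compile f (ins ∘ suc) out (3 + free) ▷
    loop free (precBody g ins out free) (clear (1 + free))
  compile (mini f)          ins out free =
    compile f (out ▸ ins) free (suc free) ▷ loop free (miniBody f ins out free) end

  compileAll : ∀ {m n} → Vec (Rec n) m → (ins : Fin n → ℕ) (out free : ℕ) → Prog
  compileAll []       ins out free = end
  compileAll (g ∷ gs) ins out free = compile g ins out free ▷ compileAll gs ins (suc out) free

  -- Register `free` counts the iterations still to come, `1 + free` is the index of the current
  -- one, `out` holds the value so far, and `2 + free` receives the next value before it replaces
  -- that in `out`.
  precBody : ∀ {n} → Rec (2 + n) → (ins : Fin (suc n) → ℕ) (out free : ℕ) → Prog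
  precBody g ins out free =
    compile g ((1 + free) ▸ out ▸ ins ∘ suc) (2 + free) (3 + free) ▷
    clear out ▷ transfer (2 + free) (out ∷ []) ▷ incs ((1 + free) ∷ [])

  -- Register `out` is the candidate and `free` the value of `f` at it. The loop on `free` stops at
  -- the first value zero; the remainder of a positive value is cleared before the next candidate is
  -- tried.
  miniBody : ∀ {n} → Rec (suc n) → (ins : Fin n → ℕ) (out free : ℕ) → Prog
  miniBody f ins out free =
    clear free ▷ incs (out ∷ []) ▷ compile f (out ▸ ins) free (suc free)

-- Correctness of the compilation

record Ready {n} (xs : Vec ℕ n) (ins : Fin n → ℕ) (out free : ℕ) (σ : Store) : Set where
  field
    out<free : out < free
    ins<free : ∀ i → ins i < free
    ins≢out  : ∀ i → ins i ≢ out
    args     : ∀ i → σ (ins i) ≡ lookup xs i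
    blank    : σ out ≡ 0
    clean    : ∀ q → free ≤ q → σ q ≡ 0

Correct : ∀ {n} → Rec n → Set
Correct f = ∀ {xs y} → f [ xs ]⇓ y → ∀ {ins out free σ} → Ready xs ins out free σ →
            Ends (compile f ins out free) σ (Sets σ out y)

clearAll-ends : ∀ o m σ → (∀ q → o + m ≤ q → σ q ≡ 0) →
                Ends (clearAll o m) σ
                  (λ τ → (∀ q → q < o → τ q ≡ σ q) × (∀ q → o ≤ q → τ q ≡ 0))
clearAll-ends o zero    σ clean =
  end-ends ((λ q _ → refl) , λ q o≤q → clean q (subst (_≤ q) (sym (+-identityʳ o)) o≤q))
clearAll-ends o (suc m) σ clean =
  clear-ends o σ then λ τ (τo , τq) →
  weaken (clearAll-ends (suc o) m τ (λ q le →
            trans (τq q (>⇒≢ (≤-trans (s≤s (m≤m+n o m)) le)))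
                  (clean q (subst (_≤ q) (sym (+-suc o m)) le))))
    λ {υ} (lower , upper) →
      (λ q q<o → trans (lower q (m<n⇒m<1+n q<o)) (τq q (<⇒≢ q<o))) ,
      λ q o≤q → at τ υ τo lower upper q (q ≟ o) o≤q
  where
  at : ∀ τ υ → τ o ≡ 0 → (∀ q → q < suc o → υ q ≡ τ q) → (∀ q → suc o ≤ q → υ q ≡ 0) →
       ∀ q → Dec (q ≡ o) → o ≤ q → υ q ≡ 0
  at τ υ τo lower upper q (yes refl) _   = trans (lower q ≤-refl) τo
  at τ υ τo lower upper q (no q≢o)   o≤q = upper q (≤∧≢⇒< o≤q (q≢o ∘ sym))

-- The values go to consecutive registers: `out` moves up along the vector while `free` stays put,
-- so the outputs must fit below `free`. Everything from `out` onwards is required to be zero,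
-- because it includes the outputs still to be written.
AllCorrect : ∀ {m n} → Vec (Rec n) m → Set
AllCorrect {m} gs =
  ∀ {xs} {ys : Vec ℕ m} → Pointwise (λ g y → g [ xs ]⇓ y) gs ys → ∀ {ins out free σ} →
  out + m ≤ free → (∀ i → ins i < out) → (∀ i → σ (ins i) ≡ lookup xs i) →
  (∀ q → out ≤ q → σ q ≡ 0) →
  Ends (compileAll gs ins out free) σ
    (λ τ → (∀ j → τ (out + toℕ j) ≡ lookup ys j) ×
           (∀ q → q < out → τ q ≡ σ q) × (∀ q → out + m ≤ q → τ q ≡ 0))

all-correct-[] : ∀ {n} → AllCorrect {n = n} []
all-correct-[] [] {out = out} le ins< args clean =
  end-ends ((λ ()) , (λ q _ → refl) ,
            λ q o≤q → clean q (subst (_≤ q) (+-identityʳ out) o≤q))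

all-correct-∷ : ∀ {m n} {g : Rec n} {gs : Vec (Rec n) m} →
                Correct g → AllCorrect gs → AllCorrect (g ∷ gs)
all-correct-∷ {m} g-correct gs-correct {xs} {y ∷ ys} (d ∷ ds) {ins} {out} {free} {σ}
              le ins< args clean =
  g-correct d (record
    { out<free = out<free
    ; ins<free = λ i → <-trans (ins< i) out<free
    ; ins≢out  = λ i → <⇒≢ (ins< i)
    ; args     = args
    ; blank    = clean out ≤-refl
    ; clean    = λ q le′ → clean q (≤-trans (<⇒≤ out<free) le′)
    })
  then λ τ (τo , τq) →
  weaken (gs-correct ds (subst (_≤ free) (+-suc out m) le)
            (λ i → m<n⇒m<1+n (ins< i))
            (λ i → trans (τq _ (<⇒≢ (ins< i))) (args i))
            (λ q o<q → trans (τq q (>⇒≢ o<q)) (clean q (<⇒≤ o<q))))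
    λ {υ} (values , lower , upper) →
      (λ where
        zero    → trans (cong υ (+-identityʳ out)) (trans (lower out ≤-refl) τo)
        (suc j) → trans (cong υ (+-suc out (toℕ j))) (values j)) ,
      (λ q q<o → trans (lower q (m<n⇒m<1+n q<o)) (τq q (<⇒≢ q<o))) ,
      λ q le′ → upper q (subst (_≤ q) (+-suc out m) le′)
  where
  out<free : out < free
  out<free = ≤-trans (m<m+n out (s≤s z≤n)) le

succ-correct : Correct succ
succ-correct succ⇓ {ins} {out} {free} {σ} ready =
  copy-ends (ins zero) out free σ (ins≢out zero ∘ sym) (>⇒≢ (ins<free zero))
    (>⇒≢ out<free) blank (clean free ≤-refl)
  then λ τ (τo , τq) →
  inc-ends (end-ends
    (trans (≔-same τ out _) (cong suc (trans τo (args zero))) ,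
     λ q q≢o → trans (≔-other τ out _ q q≢o) (τq q q≢o)))
  where open Ready ready

proj-correct : ∀ {n} (i : Fin n) → Correct (proj i)
proj-correct i proj⇓ {ins} {out} {free} {σ} ready =
  weaken (copy-ends (ins i) out free σ (ins≢out i ∘ sym) (>⇒≢ (ins<free i))
           (>⇒≢ out<free) blank (clean free ≤-refl))
    λ (τo , τq) → trans τo (args i) , τq
  where open Ready ready

comp-correct : ∀ {m n} {f : Rec m} {gs : Vec (Rec n) m} →
               Correct f → AllCorrect gs → Correct (comp f gs)
comp-correct {m} f-correct gs-correct {xs} {z} (comp⇓ ds d) {ins} {out} {free} {σ} ready =
  gs-correct ds ≤-refl ins<free args clean
  then λ τ (values , lower , upper) →
  f-correct d (record
    { out<free = ≤-trans out<free (m≤m+n free m)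
    ; ins<free = λ j → +-monoʳ-< free (toℕ<n j)
    ; ins≢out  = λ j → >⇒≢ (≤-trans out<free (m≤m+n free (toℕ j)))
    ; args     = values
    ; blank    = trans (lower out out<free) blank
    ; clean    = upper
    })
  then λ υ (υo , υq) →
  weaken (clearAll-ends free m υ (λ q le →
            trans (υq q (>⇒≢ (≤-trans out<free (≤-trans (m≤m+n free m) le)))) (upper q le)))
    λ {φ} (lower′ , upper′) →
      trans (lower′ out out<free) υo ,
      λ q q≢o → at τ υ φ lower υq lower′ upper′ q q≢o (q <? free)
  where
  open Ready ready
  at : ∀ (τ υ φ : Store) → (∀ q → q < free → τ q ≡ σ q) → (∀ q → q ≢ out → υ q ≡ τ q) →
       (∀ q → q < free → φ q ≡ υ q) → (∀ q → free ≤ q → φ q ≡ 0) →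
       ∀ q → q ≢ out → Dec (q < free) → φ q ≡ σ q
  at τ υ φ lower υq lower′ upper′ q q≢o (yes q<) =
    trans (lower′ q q<) (trans (υq q q≢o) (lower q q<))
  at τ υ φ lower υq lower′ upper′ q q≢o (no q≮) =
    trans (upper′ q (≮⇒≥ q≮)) (sym (clean q (≮⇒≥ q≮)))

module _ {n : ℕ} {f : Rec n} {g : Rec (2 + n)} (f-correct : Correct f) (g-correct : Correct g)
         {xs : Vec ℕ n} {ins : Fin (suc n) → ℕ} {out free : ℕ}
         (out<free : out < free)
         (ins<free : ∀ i → ins (suc i) < free) (ins≢out : ∀ i → ins (suc i) ≢ out) where

  precBody-ends : ∀ {k y z σ} → g [ k ∷ y ∷ xs ]⇓ z →
    (∀ i → σ (ins (suc i)) ≡ lookup xs i) → σ (1 + free) ≡ k → σ out ≡ y →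
    (∀ q → 2 + free ≤ q → σ q ≡ 0) →
    Ends (precBody g ins out free) σ
      (λ τ → τ (1 + free) ≡ suc k × τ out ≡ z ×
             (∀ q → q ≢ 1 + free → q ≢ out → τ q ≡ σ q))
  precBody-ends {k} {y} {z} {σ} d args σj σo clean =
    g-correct d (record
      { out<free = ≤-refl
      ; ins<free = λ where
          zero          → m<n⇒m<1+n ≤-refl
          (suc zero)    → m<n⇒m<o+n 3 out<free
          (suc (suc i)) → m<n⇒m<o+n 3 (ins<free i)
      ; ins≢out  = λ where
          zero          → <⇒≢ ≤-refl
          (suc zero)    → out≢new
          (suc (suc i)) → <⇒≢ (m<n⇒m<o+n 2 (ins<free i))
      ; args     = λ where
          zero          → σj
          (suc zero)    → σo
          (suc (suc i)) → args i
      ; blank    = clean _ ≤-refl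
      ; clean    = λ q le → clean q (≤-trans (n≤1+n _) le)
      })
    then λ τ₁ (τ₁n , τ₁q) → clear-ends out τ₁
    then λ τ₂ (τ₂o , τ₂q) → move-ends (2 + free) out τ₂ out≢new τ₂o
    then λ τ₃ (τ₃n , τ₃o , τ₃q) → weaken (incs-ends ((1 + free) ∷ []) τ₃)
    λ {τ₄} τ₄q →
      trans (τ₄q (1 + free))
        (cong₂ _+_ (count-same (1 + free) [])
          (trans (τ₃q _ (<⇒≢ ≤-refl) (>⇒≢ (m<n⇒m<1+n out<free)))
            (trans (τ₂q _ (>⇒≢ (m<n⇒m<1+n out<free))) (trans (τ₁q _ (<⇒≢ ≤-refl)) σj)))) ,
      trans (τ₄q out)
        (cong₂ _+_ (count-other [] (<⇒≢ (m<n⇒m<1+n out<free)))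
          (trans τ₃o (trans (τ₂q _ (>⇒≢ (m<n⇒m<o+n 2 out<free))) τ₁n))) ,
      λ q q≢j q≢o → trans (τ₄q q) (trans (cong (_+ τ₃ q) (count-other [] q≢j))
        (at τ₁ τ₂ τ₃ τ₁q τ₂q τ₃n τ₃q q q≢o (q ≟ 2 + free)))
    where
    m<n⇒m<o+n : ∀ {m n} o → m < n → m < o + n
    m<n⇒m<o+n o m<n = ≤-trans m<n (m≤n+m _ o)
    out≢new : out ≢ 2 + free
    out≢new = <⇒≢ (m<n⇒m<o+n 2 out<free)
    at : ∀ (τ₁ τ₂ τ₃ : Store) → (∀ q → q ≢ 2 + free → τ₁ q ≡ σ q) →
         (∀ q → q ≢ out → τ₂ q ≡ τ₁ q) → τ₃ (2 + free) ≡ 0 →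
         (∀ q → q ≢ 2 + free → q ≢ out → τ₃ q ≡ τ₂ q) →
         ∀ q → q ≢ out → Dec (q ≡ 2 + free) → τ₃ q ≡ σ q
    at τ₁ τ₂ τ₃ τ₁q τ₂q τ₃n τ₃q q q≢o (yes refl) = trans τ₃n (sym (clean q ≤-refl))
    at τ₁ τ₂ τ₃ τ₁q τ₂q τ₃n τ₃q q q≢o (no q≢n)   =
      trans (τ₃q q q≢n q≢o) (trans (τ₂q q q≢o) (τ₁q q q≢n))

  precLoop : Prog
  precLoop = loop free (precBody g ins out free) (clear (1 + free))

  -- By induction on the derivation. The number `m` of iterations left over after the `k`-th has to
  -- vary: the derivation for the predecessor of `k` leaves one more, which the loop then consumes.
  prec-iterates : ∀ {k y} → prec f g [ k ∷ xs ]⇓ y → ∀ m {σ} → σ free ≡ k + m →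
    (∀ i → σ (ins (suc i)) ≡ lookup xs i) → σ out ≡ 0 →
    (∀ q → 1 + free ≤ q → σ q ≡ 0) →
    ∃[ τ ] (∀ K → Star (Move progInstr)
                    (compile f (ins ∘ suc) out (3 + free) ▷ precLoop ▷ K , σ)
                    (precLoop ▷ K , τ)) ×
           τ free ≡ m × τ (1 + free) ≡ k × τ out ≡ y ×
           (∀ q → q ≢ free → q ≢ 1 + free → q ≢ out → τ q ≡ σ q)
  prec-iterates (base⇓ d) m {σ} σt args σo clean
    with τ , fs , τo , τq ← f-correct d {ins ∘ suc} {out} {3 + free} {σ} (record
           { out<free = ≤-trans out<free (m≤n+m free 3)
           ; ins<free = λ i → ≤-trans (ins<free i) (m≤n+m free 3)
           ; ins≢out  = ins≢out
           ; args     = args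
           ; blank    = σo
           ; clean    = λ q le → clean q (≤-trans (m≤n+m (1 + free) 2) le)
           }) =
    τ , (λ K → fs (precLoop ▷ K)) ,
    trans (τq _ (>⇒≢ out<free)) σt ,
    trans (τq _ (>⇒≢ (m<n⇒m<1+n out<free))) (clean _ ≤-refl) ,
    τo , λ q _ _ q≢o → τq q q≢o
  prec-iterates (step⇓ {k = k} d d′) m {σ} σt args σo clean
    with τ , fs , τt , τj , τo , τq ←
           prec-iterates d (suc m) (trans σt (sym (+-suc k m))) args σo clean
    with υ , bs , υj , υo , υq ←
           loop-enter {p = clear (1 + free)} τt (precBody-ends {σ = τ [ free ≔ m ]} d′
             (λ i → trans (≔-other τ free m _ (<⇒≢ (ins<free i)))
               (trans (τq _ (<⇒≢ (ins<free i)) (<⇒≢ (m<n⇒m<1+n (ins<free i))) (ins≢out i))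
                 (args i)))
             (trans (≔-other τ free m _ (>⇒≢ ≤-refl)) τj)
             (trans (≔-other τ free m _ (<⇒≢ out<free)) τo)
             (λ q le → trans (≔-other τ free m q (>⇒≢ (≤-trans (n≤1+n _) le)))
               (trans (τq q (>⇒≢ (≤-trans (n≤1+n _) le)) (>⇒≢ le)
                             (>⇒≢ (≤-trans out<free (≤-trans (m≤n+m free 2) le))))
                 (clean q (≤-trans (n≤1+n _) le))))) =
    υ , (λ K → fs K ◅◅ bs K) ,
    trans (υq _ (<⇒≢ ≤-refl) (>⇒≢ out<free)) (≔-same τ free m) ,
    υj , υo ,
    λ q q≢t q≢j q≢o → trans (υq q q≢j q≢o)
      (trans (≔-other τ free m q q≢t) (τq q q≢t q≢j q≢o))

prec-correct : ∀ {n} {f : Rec n} {g : Rec (2 + n)} →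
               Correct f → Correct g → Correct (prec f g)
prec-correct {f = f} {g} f-correct g-correct {k ∷ xs} {y} d {ins} {out} {free} {σ} ready =
  copy-ends (ins zero) free (3 + free) σ (>⇒≢ (ins<free zero))
    (>⇒≢ (≤-trans (ins<free zero) (m≤n+m free 3))) (>⇒≢ (m≤n+m (suc free) 2))
    (clean free ≤-refl) (clean (3 + free) (m≤n+m free 3))
  then λ τ (τt , τq) → looping τ τt τq
  where
  open Ready ready
  Q : Store → Set
  Q = Sets σ out y
  looping : ∀ τ → τ free ≡ σ (ins zero) → (∀ q → q ≢ free → τ q ≡ σ q) →
            Ends (compile f (ins ∘ suc) out (3 + free) ▷
                  loop free (precBody g ins out free) (clear (1 + free))) τ Q
  looping τ τt τq
    with υ , fs , υt , υj , υo , υq ←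
           prec-iterates f-correct g-correct {ins = ins} out<free (ins<free ∘ suc) (ins≢out ∘ suc)
             d 0 {τ} (trans τt (trans (args zero) (sym (+-identityʳ k))))
             (λ i → trans (τq _ (<⇒≢ (ins<free (suc i)))) (args (suc i)))
             (trans (τq _ (<⇒≢ out<free)) blank)
             (λ q le → trans (τq q (>⇒≢ le)) (clean q (<⇒≤ le)))
    with φ , cs , φj , φq ← clear-ends (1 + free) υ =
    φ ,
    (λ K → subst (λ p → Star (Move progInstr) (p , τ) (K , φ))
             (sym (▷-assoc (compile f (ins ∘ suc) out (3 + free)) _ K))
             (fs K ◅◅ loop-exit K υt ◅◅ cs K)) ,
    trans (φq _ (<⇒≢ (m<n⇒m<1+n out<free))) υo ,
    λ q q≢o → at q q≢o (q ≟ free) (q ≟ 1 + free)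
    where
    at : ∀ q → q ≢ out → Dec (q ≡ free) → Dec (q ≡ 1 + free) → φ q ≡ σ q
    at q q≢o (yes refl) _          = trans (φq q (<⇒≢ ≤-refl)) (trans υt (sym (clean q ≤-refl)))
    at q q≢o (no q≢t)   (yes refl) = trans φj (sym (clean q (n≤1+n free)))
    at q q≢o (no q≢t)   (no q≢j)   =
      trans (φq q q≢j) (trans (υq q q≢t q≢j q≢o) (τq q q≢t))

module _ {n : ℕ} {f : Rec (suc n)} (f-correct : Correct f)
         {xs : Vec ℕ n} {ins : Fin n → ℕ} {out free : ℕ}
         (out<free : out < free)
         (ins<free : ∀ i → ins i < free) (ins≢out : ∀ i → ins i ≢ out) where

  private
    eval : Prog
    eval = compile f (out ▸ ins) free (suc free)

  eval-ends : ∀ {k v σ} → f [ k ∷ xs ]⇓ v → (∀ i → σ (ins i) ≡ lookup xs i) →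
              σ out ≡ k → (∀ q → free ≤ q → σ q ≡ 0) → Ends eval σ (Sets σ free v)
  eval-ends d args σo clean = f-correct d record
    { out<free = ≤-refl
    ; ins<free = λ { zero → m<n⇒m<1+n out<free ; (suc i) → m<n⇒m<1+n (ins<free i) }
    ; ins≢out  = λ { zero → <⇒≢ out<free ; (suc i) → <⇒≢ (ins<free i) }
    ; args     = λ { zero → σo ; (suc i) → args i }
    ; blank    = clean free ≤-refl
    ; clean    = λ q le → clean q (<⇒≤ le)
    }

  miniBody-ends : ∀ {k v σ} → f [ suc k ∷ xs ]⇓ v → (∀ i → σ (ins i) ≡ lookup xs i) →
    σ out ≡ k → (∀ q → 1 + free ≤ q → σ q ≡ 0) →
    Ends (miniBody f ins out free) σ
      (λ τ → τ free ≡ v × τ out ≡ suc k × (∀ q → q ≢ free → q ≢ out → τ q ≡ σ q))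
  miniBody-ends {k} {v} {σ} d args σo clean =
    clear-ends free σ
    then λ τ₁ (τ₁t , τ₁q) → incs-ends (out ∷ []) τ₁
    then λ τ₂ τ₂q →
    let τ₂o : τ₂ out ≡ suc k
        τ₂o = trans (τ₂q out)
                (cong₂ _+_ (count-same out []) (trans (τ₁q _ (<⇒≢ out<free)) σo))
        τ₂t : τ₂ free ≡ 0
        τ₂t = trans (τ₂q free) (cong₂ _+_ (count-other [] (>⇒≢ out<free)) τ₁t)
        τ₂q′ : ∀ q → q ≢ free → q ≢ out → τ₂ q ≡ σ q
        τ₂q′ q q≢t q≢o = trans (τ₂q q) (cong₂ _+_ (count-other [] q≢o) (τ₁q q q≢t))
    in weaken (eval-ends d
         (λ i → trans (τ₂q′ _ (<⇒≢ (ins<free i)) (ins≢out i)) (args i))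
         τ₂o
         (λ q le → cleared τ₂ τ₂t τ₂q′ q le (q ≟ free)))
       λ (φt , φq) → φt , trans (φq _ (<⇒≢ out<free)) τ₂o ,
                     λ q q≢t q≢o → trans (φq q q≢t) (τ₂q′ q q≢t q≢o)
    where
    cleared : ∀ (τ₂ : Store) → τ₂ free ≡ 0 → (∀ q → q ≢ free → q ≢ out → τ₂ q ≡ σ q) →
              ∀ q → free ≤ q → Dec (q ≡ free) → τ₂ q ≡ 0
    cleared τ₂ τ₂t τ₂q q le (yes refl) = τ₂t
    cleared τ₂ τ₂t τ₂q q le (no q≢t)   =
      trans (τ₂q q q≢t (>⇒≢ (≤-trans out<free le))) (clean q (≤∧≢⇒< le (q≢t ∘ sym)))

  miniLoop : Prog
  miniLoop = loop free (miniBody f ins out free) end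

  -- By induction on the candidate `k`. Below `y` the value of `f` is a successor, which is what the
  -- loop needs in order to be entered once more.
  mini-iterates : ∀ k {y v σ} → (∀ {k} → k < y → ∃[ z ] f [ k ∷ xs ]⇓ suc z) →
    k ≤ y → f [ k ∷ xs ]⇓ v →
    (∀ i → σ (ins i) ≡ lookup xs i) → σ out ≡ 0 → (∀ q → free ≤ q → σ q ≡ 0) →
    ∃[ τ ] (∀ K → Star (Move progInstr) (eval ▷ miniLoop ▷ K , σ) (miniLoop ▷ K , τ)) ×
           τ free ≡ v × τ out ≡ k × (∀ q → q ≢ free → q ≢ out → τ q ≡ σ q)
  mini-iterates zero {σ = σ} below k≤y d args σo clean
    with τ , fs , τt , τq ← eval-ends {σ = σ} d args σo clean =
    τ , (λ K → fs (miniLoop ▷ K)) , τt , trans (τq _ (<⇒≢ out<free)) σo , λ q q≢t _ → τq q q≢t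
  mini-iterates (suc k) {v = v} {σ = σ} below k<y d args σo clean
    with z , d′ ← below k<y
    with τ , fs , τt , τo , τq ← mini-iterates k below (<⇒≤ k<y) d′ args σo clean
    with φ , bs , φt , φo , φq ← loop-enter {p = end} τt (miniBody-ends d
           (λ i → trans (≔-other τ free z _ (<⇒≢ (ins<free i)))
             (trans (τq _ (<⇒≢ (ins<free i)) (ins≢out i)) (args i)))
           (trans (≔-other τ free z _ (<⇒≢ out<free)) τo)
           (λ q le → trans (≔-other τ free z q (>⇒≢ le))
             (trans (τq q (>⇒≢ le) (>⇒≢ (<-trans out<free le))) (clean q (<⇒≤ le))))) =
    φ , (λ K → fs K ◅◅ bs K) , φt , φo ,
    λ q q≢t q≢o → trans (φq q q≢t q≢o) (trans (≔-other τ free z q q≢t) (τq q q≢t q≢o))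

mini-correct : ∀ {n} {f : Rec (suc n)} → Correct f → Correct (mini f)
mini-correct {f = f} f-correct {xs} {y} (mini⇓ below d) {ins} {out} {free} {σ} ready
  with τ , fs , τt , τo , τq ←
         mini-iterates f-correct (Ready.out<free ready) (Ready.ins<free ready)
           (Ready.ins≢out ready) y {σ = σ} below ≤-refl d
           (Ready.args ready) (Ready.blank ready) (Ready.clean ready) =
  τ ,
  (λ K → subst (λ p → Star (Move progInstr) (p , σ) (K , τ))
           (sym (▷-assoc (compile f (out ▸ ins) free (suc free)) _ K))
           (fs K ◅◅ loop-exit K τt)) ,
  τo , λ q q≢o → at q q≢o (q ≟ free)
  where
  open Ready ready
  at : ∀ q → q ≢ out → Dec (q ≡ free) → τ q ≡ σ q
  at q q≢o (yes refl) = trans τt (sym (clean q ≤-refl))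
  at q q≢o (no q≢t)   = τq q q≢t q≢o

mutual

  compile-correct : ∀ {n} (f : Rec n) → Correct f
  compile-correct zer         zer⇓ ready = end-ends (Ready.blank ready , λ q _ → refl)
  compile-correct succ        = succ-correct
  compile-correct (proj i)    = proj-correct i
  compile-correct (comp f gs) =
    comp-correct {f = f} {gs} (compile-correct f) (compileAll-correct gs)
  compile-correct (prec f g)  =
    prec-correct {f = f} {g} (compile-correct f) (compile-correct g)
  compile-correct (mini f)    = mini-correct {f = f} (compile-correct f)

  compileAll-correct : ∀ {m n} (gs : Vec (Rec n) m) → AllCorrect gs
  compileAll-correct []       = all-correct-[]
  compileAll-correct (g ∷ gs) =
    all-correct-∷ {g = g} {gs} (compile-correct g) (compileAll-correct gs)

-- The protocol

data Ctl : Set where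
  load : ℕ → Ctl
  run  : Prog → Ctl

data Letter : Set where
  ok   : Letter
  swap : (x y : ℕ) → Letter

data Msg : Set where
  init bye : Msg
  letter   : Letter → Msg

-- A `root₁` has sent `init` and still lacks a predecessor; a `linked` agent has a predecessor and
-- still has to send its own `init`. In `mid b x` a cell has read a letter, still owes the letter
-- `b`, and is about to contain `x`.
data St : Set where
  start root₁ linked : St
  ctl wait           : Ctl → St
  cell               : ℕ → St
  mid                : Letter → ℕ → St

-- A cell contains 0 if it is blank and suc r if it is a unit of register r;
-- swap x y turns the first x that it meets into y, and then becomes ok.
pass : Letter → ℕ → Letter × ℕ
pass ok         z = ok , z
pass (swap x y) z with z ≟ x
... | yes _ = ok , y
... | no  _ = swap x y , z

request : ∀ {C} → Instr C → Letter
request (incr r c)    = swap 0 (suc r)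
request (decr r c c₀) = swap (suc r) 0

-- A request that returns unchanged has met no suitable cell. For a decrement this is the zero test.
-- For an increment it means that no blank cell is left; the root has no transition for it and stays
-- blocked.
data Reply {C : Set} : Instr C → Letter → C → Set where
  incr : ∀ {r c}    → Reply (incr r c) ok c
  decr : ∀ {r c c₀} → Reply (decr r c c₀) ok c
  none : ∀ {r c c₀} → Reply (decr r c c₀) (swap (suc r) 0) c₀

Transition : Set
Transition = St × Op Msg 2 × St

pattern own  = zero
pattern link = suc zero

rootEdges : Ctl → Instr Ctl → List Transition
rootEdges c (incr r c′)    =
  (ctl c , br (letter (swap 0 (suc r))) own , wait c) ∷
  (wait c , rec (letter ok) link == , ctl c′) ∷ []
rootEdges c (decr r c′ c₀) =
  (ctl c , br (letter (swap (suc r) 0)) own , wait c) ∷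
  (wait c , rec (letter ok) link == , ctl c′) ∷
  (wait c , rec (letter (swap (suc r) 0)) link == , ctl c₀) ∷ []

passEdges : ℕ → Letter → List Transition
passEdges x l =
  let b , x′ = pass l x in
  (cell x , rec (letter l) link == , mid b x′) ∷ (mid b x′ , br (letter b) own , cell x′) ∷ []

-- Unrolling a loop creates programs that are not subterms of the original one. Recording the
-- continuation `k` shows that only finitely many control points arise.
positions : Prog → Prog → List Prog
positions end          k = []
positions stuck        k = []
positions (inc r p)    k = (inc r p ▷ k) ∷ positions p k
positions (loop r b p) k =
  (loop r b p ▷ k) ∷ positions b (loop r b p ▷ k) ++ positions p k

loadEdges : ℕ → List Transition
loadEdges zero    = []
loadEdges (suc j) = rootEdges (load (suc j)) (incr 0 (load j)) ++ loadEdges j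

-- All agents must end in one state, so cells move to the halting state of the roots. Every
-- transition carries an operation; `bye` is a message that no transition receives.
leaveEdge : ℕ → Transition
leaveEdge x = cell x , br bye own , ctl (run end)

mapInstr : ∀ {C D : Set} → (C → D) → Instr C → Instr D
mapInstr f (incr r c)    = incr r (f c)
mapInstr f (decr r c c₀) = decr r (f c) (f c₀)

register : ∀ {C} → Instr C → ℕ
register (incr r _)   = r
register (decr r _ _) = r

module Fixed (main : Prog) where

  -- The loader leaves e in register 0; the unit in register 1 is a by-product.
  instr : Ctl → Maybe (Instr Ctl)
  instr (load zero)    = just (incr 1 (run main))
  instr (load (suc j)) = just (incr 0 (load j))
  instr (run p)        = Maybe.map (mapInstr run) (progInstr p)

  -- Of the loader only `load 0` is listed. The other loading transitions come from `loadEdges`,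
  -- which keeps `fixed` independent of `e`, as it must be for `e` to be its code.
  ctls : List Ctl
  ctls = load 0 ∷ map run (positions main end)

  ctlEdges : Ctl → List Transition
  ctlEdges c = maybe′ (rootEdges c) [] (instr c)

  content : Ctl → ℕ
  content c = suc (maybe′ register 0 (instr c))

  contents : List ℕ
  -- The content `1` is a unit of register 0, which the loader increments.
  contents = 0 ∷ 1 ∷ map content ctls

  letters : List Letter
  letters = ok ∷ concatMap (λ x → map (swap x) contents) contents

  fixed : List Transition
  fixed =
    (start , br init own , root₁) ∷
    (start , rec init link ↓ , linked) ∷
    (linked , br init own , cell 0) ∷
    map leaveEdge contents ++
    concatMap ctlEdges ctls ++
    concatMap (λ x → concatMap (passEdges x) letters) contents

-- Numbering of states and messages

treeProg : Prog → Tree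
treeProg end          = leaf 0
treeProg stuck        = leaf 1
treeProg (inc r p)    = leaf r · treeProg p
treeProg (loop r b p) = (leaf r · treeProg b) · treeProg p

untreeProg : Tree → Prog
untreeProg (leaf 0)             = end
untreeProg (leaf _)             = stuck
untreeProg (leaf r · t)         = inc r (untreeProg t)
untreeProg ((leaf r · s) · t)   = loop r (untreeProg s) (untreeProg t)
untreeProg (((_ · _) · _) · _)  = end

untree-treeProg : ∀ p → untreeProg (treeProg p) ≡ p
untree-treeProg end          = refl
untree-treeProg stuck        = refl
untree-treeProg (inc r p)    = cong (inc r) (untree-treeProg p)
untree-treeProg (loop r b p) = cong₂ (loop r) (untree-treeProg b) (untree-treeProg p)

treeCtl : Ctl → Tree
treeCtl (load j) = leaf j
treeCtl (run p)  = leaf 0 · treeProg p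

untreeCtl : Tree → Ctl
untreeCtl (leaf j) = load j
untreeCtl (_ · t)  = run (untreeProg t)

untree-treeCtl : ∀ c → untreeCtl (treeCtl c) ≡ c
untree-treeCtl (load j) = refl
untree-treeCtl (run p)  = cong run (untree-treeProg p)

treeLetter : Letter → Tree
treeLetter ok         = leaf 0
treeLetter (swap x y) = leaf x · leaf y

untreeLetter : Tree → Letter
untreeLetter (leaf x · leaf y) = swap x y
untreeLetter _                 = ok

untree-treeLetter : ∀ l → untreeLetter (treeLetter l) ≡ l
untree-treeLetter ok         = refl
untree-treeLetter (swap x y) = refl

treeMsg : Msg → Tree
treeMsg init       = leaf 0
treeMsg bye        = leaf 1
treeMsg (letter l) = leaf 0 · treeLetter l

untreeMsg : Tree → Msg
untreeMsg (leaf 0) = init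
untreeMsg (leaf _) = bye
untreeMsg (_ · t)  = letter (untreeLetter t)

untree-treeMsg : ∀ m → untreeMsg (treeMsg m) ≡ m
untree-treeMsg init       = refl
untree-treeMsg bye        = refl
untree-treeMsg (letter l) = cong letter (untree-treeLetter l)

treeSt : St → Tree
treeSt start     = leaf 0
treeSt root₁     = leaf 1
treeSt linked    = leaf 2
treeSt (ctl c)   = leaf 0 · treeCtl c
treeSt (wait c)  = leaf 1 · treeCtl c
treeSt (cell x)  = leaf 2 · leaf x
treeSt (mid b x) = leaf 3 · leaf x · treeLetter b

untreeSt : Tree → St
untreeSt (leaf 0)              = start
untreeSt (leaf 1)              = root₁
untreeSt (leaf _)              = linked
untreeSt (leaf 0 · t)          = ctl (untreeCtl t)
untreeSt (leaf 1 · t)          = wait (untreeCtl t)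
untreeSt (leaf 2 · leaf x)     = cell x
untreeSt (leaf 3 · leaf x · t) = mid (untreeLetter t) x
untreeSt _                     = start

untree-treeSt : ∀ s → untreeSt (treeSt s) ≡ s
untree-treeSt start     = refl
untree-treeSt root₁     = refl
untree-treeSt linked    = refl
untree-treeSt (ctl c)   = cong ctl (untree-treeCtl c)
untree-treeSt (wait c)  = cong wait (untree-treeCtl c)
untree-treeSt (cell x)  = refl
untree-treeSt (mid b x) = cong (λ b → mid b x) (untree-treeLetter b)

codeSt : St → ℕ
codeSt s = codeTree (treeSt s)

codeMsg : Msg → ℕ
codeMsg m = codeTree (treeMsg m)

left-inverse⇒injective : ∀ {A : Set} (tree : A → Tree) (untree : Tree → A) →
  (∀ x → untree (tree x) ≡ x) → ∀ x y → codeTree (tree x) ≡ codeTree (tree y) → x ≡ y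
left-inverse⇒injective tree untree inv x y eq =
  trans (sym (inv x)) (trans (cong untree (codeTree-injective (tree x) (tree y) eq)) (inv y))

codeSt-injective : ∀ s t → codeSt s ≡ codeSt t → s ≡ t
codeSt-injective = left-inverse⇒injective treeSt untreeSt untree-treeSt

codeMsg-injective : ∀ m n → codeMsg m ≡ codeMsg n → m ≡ n
codeMsg-injective = left-inverse⇒injective treeMsg untreeMsg untree-treeMsg

codeOp′ : ∀ {r} → Op Msg r → ℕ
codeOp′ (br m i)    = pair 0 (pair (codeMsg m) (toℕ i))
codeOp′ (rec m i α) = pair (suc (codeTest α)) (pair (codeMsg m) (toℕ i))

codeTransition′ : Transition → ℕ
codeTransition′ (s , o , s′) = pair (codeSt s) (pair (codeOp′ o) (codeSt s′))

clamp : (B : ℕ) → ℕ → Fin (suc B)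
clamp B k = fromℕ< (s≤s (m⊓n≤n k B))

toℕ-clamp : ∀ {B k} → k ≤ B → toℕ (clamp B k) ≡ k
toℕ-clamp {B} {k} k≤B = trans (toℕ-fromℕ< _) (m≤n⇒m⊓n≡m k≤B)

mapOp : ∀ {M N : Set} {r} → (M → N) → Op M r → Op N r
mapOp f (br m i)    = br (f m) i
mapOp f (rec m i α) = rec (f m) i α

message : ∀ {r} → Op Msg r → Msg
message (br m i)    = m
message (rec m i α) = m

clampTransition : (B : ℕ) → Transition → Fin (suc B) × Op (Fin (suc B)) 2 × Fin (suc B)
clampTransition B (s , o , s′) =
  clamp B (codeSt s) , mapOp (clamp B ∘ codeMsg) o , clamp B (codeSt s′)

codeList′ : ∀ {A : Set} → (A → ℕ) → List A → ℕ
codeList′ f = foldr (λ x n → suc (pair (f x) n)) 0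

codeList-≥ : ∀ {A : Set} (f : A → ℕ) {x xs} → x ∈ xs → f x ≤ codeList′ f xs
codeList-≥ f (here refl)               = m≤n⇒m≤1+n (pair-≥ˡ _ _)
codeList-≥ f (there {x = x} {xs} x∈xs) =
  m≤n⇒m≤1+n (≤-trans (codeList-≥ f x∈xs) (pair-≥ʳ (f x) (codeList′ f xs)))

module Network (main : Prog) (e : ℕ) where
  open Fixed main public

  opaque

    Δ : List Transition
    Δ = (root₁ , rec init link ↓ , ctl (load e)) ∷ loadEdges e ++ fixed

  -- The code of the transition list exceeds the codes of all states and messages that occur in it.
  -- Taking it as the bound on states and messages leaves only one quantity to compute for the code
  -- of the instance.
  bound : ℕ
  bound = codeList′ codeTransition′ Δ

  opaque

    P : Protocol 2
    P = record
      { #states   = suc bound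
      ; #messages = suc bound
      ; Δ         = map (clampTransition bound) Δ
      ; q₀        = clamp bound (codeSt start)
      }

    clampSt : St → Protocol.State P
    clampSt s = clamp bound (codeSt s)

    clampMsg : Msg → Protocol.Message P
    clampMsg m = clamp bound (codeMsg m)

  qf : Protocol.State P
  qf = clampSt (ctl (run end))

∈-concatMap : ∀ {A B : Set} (f : A → List B) {x y xs} → x ∈ xs → y ∈ f x → y ∈ concatMap f xs
∈-concatMap f (here refl)                = ∈-++⁺ˡ
∈-concatMap f {xs = z ∷ _} (there x∈xs) = ∈-++⁺ʳ (f z) ∘ ∈-concatMap f x∈xs

All-concatMap : ∀ {A B : Set} {P : B → Set} (f : A → List B) →
                (∀ x → All P (f x)) → ∀ xs → All P (concatMap f xs)
All-concatMap f all []       = []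
All-concatMap f all (x ∷ xs) = All.++⁺ (all x) (All-concatMap f all xs)

module _ {main : Prog} {e : ℕ} where
  open Network main e

  -- An overapproximation of `Δ` that forgets which contents and letters are listed. Soundness can
  -- then analyse transitions by cases without list membership.
  data Edge : Transition → Set where
    root-init : Edge (start , br init own , root₁)
    root-link : Edge (root₁ , rec init link ↓ , ctl (load e))
    cell-link : Edge (start , rec init link ↓ , linked)
    cell-init : Edge (linked , br init own , cell 0)
    ask       : ∀ {c i} → instr c ≡ just i →
                Edge (ctl c , br (letter (request i)) own , wait c)
    reply     : ∀ {c i l c′} → instr c ≡ just i → Reply i l c′ →
                Edge (wait c , rec (letter l) link == , ctl c′)
    tile-in   : ∀ {x l} → Edge (cell x , rec (letter l) link == ,
                                mid (proj₁ (pass l x)) (proj₂ (pass l x)))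
    tile-out  : ∀ {x l} → Edge (mid l x , br (letter l) own , cell x)
    leave     : ∀ {x} → Edge (cell x , br bye own , ctl (run end))

  root-edges : ∀ {c} i → instr c ≡ just i → All Edge (rootEdges c i)
  root-edges (incr r c)    eq = ask eq ∷ reply eq incr ∷ []
  root-edges (decr r c c₀) eq = ask eq ∷ reply eq decr ∷ reply eq none ∷ []

  ctl-edges : ∀ c → All Edge (ctlEdges c)
  ctl-edges c with instr c in eq
  ... | just i  = root-edges i eq
  ... | nothing = []

  load-edges : ∀ j → All Edge (loadEdges j)
  load-edges zero    = []
  load-edges (suc j) = All.++⁺ (root-edges {load (suc j)} (incr 0 (load j)) refl) (load-edges j)

  opaque
    unfolding Δ

    Δ-edges : All Edge Δ
    Δ-edges = root-link ∷ All.++⁺ (load-edges e) (root-init ∷ cell-link ∷ cell-init ∷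
      All.++⁺ (All.map⁺ (All.universal (λ _ → leave) contents))
        (All.++⁺ (All-concatMap ctlEdges ctl-edges ctls)
          (All-concatMap _ (λ x → All-concatMap (passEdges x) (λ l → tile-in ∷ tile-out ∷ []) letters)
             contents)))

    start∈ : (start , br init own , root₁) ∈ Δ
    start∈ = there (∈-++⁺ʳ (loadEdges e) (here refl))

    leave∈ : (cell 0 , br bye own , ctl (run end)) ∈ Δ
    leave∈ = there (∈-++⁺ʳ (loadEdges e) (there (there (there (here refl)))))

    bound-def : bound ≡ codeList′ codeTransition′
                  ((root₁ , rec init link ↓ , ctl (load e)) ∷ loadEdges e ++ fixed)
    bound-def = refl

  module _ {s : St} {o : Op Msg 2} {s′ : St} (t∈Δ : (s , o , s′) ∈ Δ) where

    private
      code≤ : codeTransition′ (s , o , s′) ≤ bound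
      code≤ = codeList-≥ codeTransition′ t∈Δ

      rest≤ : pair (codeOp′ o) (codeSt s′) ≤ bound
      rest≤ = ≤-trans (pair-≥ʳ (codeSt s) _) code≤

    source≤ : codeSt s ≤ bound
    source≤ = ≤-trans (pair-≥ˡ (codeSt s) _) code≤

    target≤ : codeSt s′ ≤ bound
    target≤ = ≤-trans (pair-≥ʳ (codeOp′ o) (codeSt s′)) rest≤

    message≤ : codeMsg (message o) ≤ bound
    message≤ = ≤-trans (op≤ o) (≤-trans (pair-≥ˡ (codeOp′ o) (codeSt s′)) rest≤)
      where
      op≤ : ∀ o → codeMsg (message o) ≤ codeOp′ o
      op≤ (br m i)    = ≤-trans (pair-≥ˡ (codeMsg m) (toℕ i)) (pair-≥ʳ 0 _)
      op≤ (rec m i α) = ≤-trans (pair-≥ˡ (codeMsg m) (toℕ i)) (pair-≥ʳ (suc (codeTest α)) _)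

  Coded : Protocol.State P → St → Set
  Coded q s = toℕ q ≡ codeSt s

  data Matches : Op (Protocol.Message P) 2 → Op Msg 2 → Set where
    br  : ∀ {m M i}   → toℕ m ≡ codeMsg M → Matches (br m i) (br M i)
    rec : ∀ {m M i α} → toℕ m ≡ codeMsg M → Matches (rec m i α) (rec M i α)

  opaque
    unfolding P

    clampSt-coded : ∀ {s} → codeSt s ≤ bound → Coded (clampSt s) s
    clampSt-coded = toℕ-clamp

    encode : ∀ {s o s′} → (s , o , s′) ∈ Δ →
             (clampSt s , mapOp clampMsg o , clampSt s′) ∈ Protocol.Δ P
    encode = ∈-map⁺ (clampTransition bound)

    -- Clamping is exact on `Δ`, as all codes there are at most `bound`. Since codes are injective,
    -- a state of `P` determines the symbolic state that it stands for.
    decode : ∀ {q o q′} → (q , o , q′) ∈ Protocol.Δ P →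
             ∃[ s ] ∃[ o′ ] ∃[ s′ ] Edge (s , o′ , s′) × Coded q s × Coded q′ s′ × Matches o o′
    decode {o = o} t∈ =
      let (s , o′ , s′) , t∈Δ , eq = ∈-map⁻ (clampTransition bound) t∈ in
      s , o′ , s′ , All.lookup Δ-edges t∈Δ ,
      trans (cong (toℕ ∘ proj₁) eq) (toℕ-clamp (source≤ t∈Δ)) ,
      trans (cong (toℕ ∘ proj₂ ∘ proj₂) eq) (toℕ-clamp (target≤ t∈Δ)) ,
      subst (λ o → Matches o o′) (sym (cong (proj₁ ∘ proj₂) eq)) (matches o′ (message≤ t∈Δ))
      where
      matches : ∀ o → codeMsg (message o) ≤ bound → Matches (mapOp clampMsg o) o
      matches (br m i)    le = br (toℕ-clamp le)
      matches (rec m i α) le = rec (toℕ-clamp le)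

    q₀-clamped : Protocol.q₀ P ≡ clampSt start
    q₀-clamped = refl

    #states-def : Protocol.#states P ≡ suc bound
    #states-def = refl

    #messages-def : Protocol.#messages P ≡ suc bound
    #messages-def = refl

  q₀-coded : Coded (Protocol.q₀ P) start
  q₀-coded = trans (cong toℕ q₀-clamped) (clampSt-coded (source≤ start∈))

  qf-coded : Coded qf (ctl (run end))
  qf-coded = clampSt-coded (target≤ leave∈)

-- The code of the constructed instance

codeList-map : ∀ {A B : Set} (f : A → ℕ) (g : B → ℕ) (h : A → B) xs →
               (∀ {x} → x ∈ xs → g (h x) ≡ f x) → codeList g (map h xs) ≡ codeList′ f xs
codeList-map f g h []       eq = refl
codeList-map f g h (x ∷ xs) eq =
  cong suc (trans (cong₂ ⟨_,_⟩ (eq (here refl)) (codeList-map f g h xs (eq ∘ there)))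
                  (pair-def (f x) (codeList′ f xs)))

pair-cong : ∀ {x x′ y y′} → x ≡ x′ → y ≡ y′ → ⟨ x , y ⟩ ≡ pair x′ y′
pair-cong refl refl = pair-def _ _

code-unfold : ∀ {r} (P : Protocol r) qf {m n d a b} → let open Protocol P in
  #states ≡ m → #messages ≡ n → codeList codeTransition Δ ≡ d → toℕ q₀ ≡ a → toℕ qf ≡ b →
  code (P , qf) ≡ pair r (pair m (pair n (pair d (pair a b))))
code-unfold P qf m n d a b = pair-cong refl (pair-cong m (pair-cong n (pair-cong d (pair-cong a b))))

code-op : ∀ {k r} (f : Msg → Fin k) (o : Op Msg r) → toℕ (f (message o)) ≡ codeMsg (message o) →
          codeOp (mapOp f o) ≡ codeOp′ o
code-op f (br m i)    eq = pair-cong refl (pair-cong eq refl)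
code-op f (rec m i α) eq = pair-cong refl (pair-cong eq refl)

opaque
  unfolding Network.P

  -- Clamped transitions have the codes of the original ones. So the bound, defined before the
  -- protocol, is also the code of the protocol's own transition list.
  Δ-code : ∀ main e → let open Network main e in
           codeList codeTransition (Protocol.Δ P) ≡ bound
  Δ-code main e = codeList-map codeTransition′ codeTransition (clampTransition bound) Δ coded
    where
    open Network main e
    coded : ∀ {t} → t ∈ Δ → codeTransition (clampTransition bound t) ≡ codeTransition′ t
    coded {s , o , s′} t∈Δ =
      pair-cong (toℕ-clamp (source≤ t∈Δ))
        (pair-cong (code-op (clamp bound ∘ codeMsg) o (toℕ-clamp (message≤ t∈Δ)))
                   (toℕ-clamp (target≤ t∈Δ)))

code-instance : ∀ main e → let open Network main e in
  code (P , qf) ≡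
  pair 2 (pair (suc bound) (pair (suc bound) (pair bound
    (pair (codeSt start) (codeSt (ctl (run end)))))))
code-instance main e =
  code-unfold P qf #states-def #messages-def (Δ-code main e) q₀-coded qf-coded
  where open Network main e

-- Codes of instances are computable

infix 4 _computes_

_computes_ : ∀ {n} → Rec n → (Vec ℕ n → ℕ) → Set
r computes f = ∀ xs → r [ xs ]⇓ f xs

addRec : Rec 2
addRec = prec (proj zero) (comp succ (proj (suc zero) ∷ []))

add-computes : ∀ x y → addRec [ x ∷ y ∷ [] ]⇓ x + y
add-computes zero    y = base⇓ proj⇓
add-computes (suc x) y = step⇓ (add-computes x y) (comp⇓ (proj⇓ ∷ []) succ⇓)

triangleRec : Rec 1
triangleRec = prec zer (comp addRec (comp succ (proj zero ∷ []) ∷ proj (suc zero) ∷ []))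

triangle-computes : ∀ x → triangleRec [ x ∷ [] ]⇓ triangle x
triangle-computes zero    = base⇓ zer⇓
triangle-computes (suc x) =
  step⇓ (triangle-computes x)
    (comp⇓ (comp⇓ (proj⇓ ∷ []) succ⇓ ∷ proj⇓ ∷ []) (add-computes (suc x) (triangle x)))

pairRec : Rec 2
pairRec = comp addRec (comp triangleRec (addRec ∷ []) ∷ proj (suc zero) ∷ [])

pair-computes : ∀ x y → pairRec [ x ∷ y ∷ [] ]⇓ pair x y
pair-computes x y = subst (pairRec [ x ∷ y ∷ [] ]⇓_) (pair-def x y)
  (comp⇓ (comp⇓ (add-computes x y ∷ []) (triangle-computes (x + y)) ∷ proj⇓ ∷ [])
         (add-computes (triangle (x + y)) y))

data Expr (n : ℕ) : Set where
  var  : Fin n → Expr n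
  num  : ℕ → Expr n
  suc : Expr n → Expr n
  pairᵉ : Expr n → Expr n → Expr n

eval : ∀ {n} → Expr n → Vec ℕ n → ℕ
eval (var i)    xs = lookup xs i
eval (num c)    xs = c
eval (suc a)   xs = suc (eval a xs)
eval (pairᵉ a b) xs = pair (eval a xs) (eval b xs)

numRec : ∀ {n} → ℕ → Rec n
numRec zero    = comp zer []
numRec (suc c) = comp succ (numRec c ∷ [])

num-computes : ∀ {n} c {xs : Vec ℕ n} → numRec c [ xs ]⇓ c
num-computes zero    = comp⇓ [] zer⇓
num-computes (suc c) = comp⇓ (num-computes c ∷ []) succ⇓

exprRec : ∀ {n} → Expr n → Rec n
exprRec (var i)    = proj i
exprRec (num c)    = numRec c
exprRec (suc a)   = comp succ (exprRec a ∷ [])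
exprRec (pairᵉ a b) = comp pairRec (exprRec a ∷ exprRec b ∷ [])

expr-computes : ∀ {n} (a : Expr n) → exprRec a computes eval a
expr-computes (var i)    xs = proj⇓
expr-computes (num c)    xs = num-computes c
expr-computes (suc a)   xs = comp⇓ (expr-computes a xs ∷ []) succ⇓
expr-computes (pairᵉ a b) xs =
  comp⇓ (expr-computes a xs ∷ expr-computes b xs ∷ []) (pair-computes _ _)

module _ {n : ℕ} where

  opExpr : Op Msg 2 → Expr n
  opExpr o = num (codeOp′ o)

  -- These spell out `codeSt (ctl (load j))` and `codeSt (wait (load j))` as expressions in `j`, so
  -- that evaluation agrees with the numbering by computation alone.
  ctlExpr waitExpr : Expr n → Expr n
  ctlExpr  j = pairᵉ (num 1) (pairᵉ (num (codeTree (leaf 0))) (pairᵉ (num 0) j))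
  waitExpr j = pairᵉ (num 1) (pairᵉ (num (codeTree (leaf 1))) (pairᵉ (num 0) j))

  transitionExpr : Expr n → Op Msg 2 → Expr n → Expr n
  transitionExpr s o s′ = pairᵉ s (pairᵉ (opExpr o) s′)

-- Under `prec`, variable 0 is the loading step `j` and variable 1 the code of the list built so
-- far; one request and one reply transition are put in front of it.
loadExpr : Expr 3
loadExpr =
  suc (pairᵉ (transitionExpr (ctlExpr (suc (var zero))) (br (letter (swap 0 1)) own)
                             (waitExpr (suc (var zero))))
    (suc (pairᵉ (transitionExpr (waitExpr (suc (var zero))) (rec (letter ok) link ==)
                                (ctlExpr (var zero)))
      (var (suc zero)))))

loadRec : Rec 2
loadRec = prec (proj zero) (exprRec loadExpr)

loadRec-computes : ∀ (ts : List Transition) j →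
  loadRec [ j ∷ codeList′ codeTransition′ ts ∷ [] ]⇓ codeList′ codeTransition′ (loadEdges j ++ ts)
loadRec-computes ts zero    = base⇓ proj⇓
loadRec-computes ts (suc j) = step⇓ (loadRec-computes ts j) (expr-computes loadExpr _)

boundExpr : Expr 2
boundExpr =
  suc (pairᵉ (transitionExpr (num (codeSt root₁)) (rec init link ↓) (ctlExpr (var zero)))
             (var (suc zero)))

boundRec : Rec 1
boundRec =
  comp (exprRec boundExpr)
    -- The same number is used as the length of the loader and as the code of the fixed transitions,
    -- which closes the self-reference.
    (proj zero ∷ comp loadRec (proj zero ∷ proj zero ∷ []) ∷ [])

codeExpr : Expr 1
codeExpr =
  pairᵉ (num 2) (pairᵉ (suc (var zero)) (pairᵉ (suc (var zero)) (pairᵉ (var zero)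
    (pairᵉ (num (codeSt start)) (num (codeSt (ctl (run end))))))))

-- Maps the code e of the fixed transitions to the code of the instance whose
-- loader provides e.
selfRec : Rec 1
selfRec = comp (exprRec codeExpr) (boundRec ∷ [])

opaque

  codeFixed : Prog → ℕ
  codeFixed main = codeList′ codeTransition′ (Fixed.fixed main)

  codeFixed-loads : ∀ main j → loadRec [ j ∷ codeFixed main ∷ [] ]⇓
                               codeList′ codeTransition′ (loadEdges j ++ Fixed.fixed main)
  codeFixed-loads main = loadRec-computes (Fixed.fixed main)

self : Prog → Instance 2
self main = Network.P main (codeFixed main) , Network.qf main (codeFixed main)

selfRec-computes : ∀ main → selfRec [ codeFixed main ∷ [] ]⇓ code (self main)
selfRec-computes main =
  subst (selfRec [ e ∷ [] ]⇓_) (sym (code-instance main e))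
    (comp⇓ (subst (boundRec [ e ∷ [] ]⇓_) (sym bound-def) bound-computes ∷ [])
           (expr-computes codeExpr _))
  where
  e : ℕ
  e = codeFixed main
  bound-computes : boundRec [ e ∷ [] ]⇓
    codeList′ codeTransition′
      ((root₁ , rec init link ↓ , ctl (load e)) ∷ loadEdges e ++ Fixed.fixed main)
  bound-computes =
    comp⇓ (proj⇓ ∷ comp⇓ (proj⇓ ∷ proj⇓ ∷ []) (codeFixed-loads main e) ∷ [])
          (expr-computes boundExpr _)

-- Soundness

Word : Set
Word = List Letter

emit : Msg → Word
emit init       = []
emit bye        = []
emit (letter l) = l ∷ []

-- An agent that has started the network is a root, rooting until it knows
-- its predecessor; all other agents become cells.
data Role : Set where
  fresh rooting rooted celled : Role

data IsRoot : Role → Set where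
  rooting : IsRoot rooting
  rooted  : IsRoot rooted

data Linked : Role → Set where
  rooted : Linked rooted
  celled : Linked celled

module _ {main : Prog} {e : ℕ} where
  open Network main e

  -- The words are read from the right: the latest letter comes first.
  data RootTrace : Ctl → (sent received : Word) → Set where
    start : RootTrace (load e) [] []
    step  : ∀ {c i l c′ S R} → RootTrace c S R → instr c ≡ just i → Reply i l c′ →
            RootTrace c′ (request i ∷ S) (l ∷ R)

  data CellTrace : ℕ → (sent received : Word) → Set where
    start : CellTrace 0 [] []
    step  : ∀ {x l S R} → CellTrace x S R →
            CellTrace (proj₂ (pass l x)) (proj₁ (pass l x) ∷ S) (l ∷ R)

  -- The role is recorded beside the state because a cell that has left shares its state with a root
  -- that has halted. The two words differ in length only for `waiting`, where a reply is due, and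
  -- for `mid`, where a letter is owed.
  data Hist : Role → St → (sent received : Word) → Set where
    fresh   : Hist fresh start [] []
    rooting : Hist rooting root₁ [] []
    root    : ∀ {c S R} → RootTrace c S R → Hist rooted (ctl c) S R
    waiting : ∀ {c i S R} → RootTrace c S R → instr c ≡ just i →
              Hist rooted (wait c) (request i ∷ S) R
    linked  : Hist celled linked [] []
    cell    : ∀ {x S R} → CellTrace x S R → Hist celled (cell x) S R
    mid     : ∀ {x l S R} → CellTrace x S R →
              Hist celled (mid (proj₁ (pass l x)) (proj₂ (pass l x))) S (l ∷ R)
    left    : ∀ {x S R} → CellTrace x S R → Hist celled (ctl (run end)) S R

  data RoleSend : Msg → Role → Role → Set where
    root-init : RoleSend init fresh rooting
    cell-init : RoleSend init celled celled
    letter    : ∀ {l r} → RoleSend (letter l) r r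
    bye       : ∀ {r} → RoleSend bye r r

  data RoleReceive : Msg → Role → Role → Set where
    root-link : RoleReceive init rooting rooted
    cell-link : RoleReceive init fresh celled
    letter    : ∀ {l r} → RoleReceive (letter l) r r

  LinkEffect : Msg → (v old new : ℕ) → Set
  LinkEffect init       v old new = new ≡ v
  LinkEffect bye        v old new = ⊥
  LinkEffect (letter _) v old new = new ≡ old × old ≡ v

  send-hist : ∀ {r s s′ S R m i} → Hist r s S R → Edge {main} {e} (s , br m i , s′) →
              ∃[ r′ ] Hist r′ s′ (emit m ++ S) R × RoleSend m r r′ × i ≡ own
  send-hist fresh          root-init = _ , rooting , root-init , refl
  send-hist linked         cell-init = _ , cell start , cell-init , refl
  send-hist (root trace)   (ask eq)  = _ , waiting trace eq , letter , refl
  -- The program `end` has no instruction, so a cell that has left never acts as a root.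
  send-hist (left _)       (ask ())
  send-hist (mid trace)    tile-out  = _ , cell (step trace) , letter , refl
  send-hist (cell trace)   leave     = _ , left trace , bye , refl

  -- A link is set only by `init`, and only before any letter has been received. This is the last
  -- conjunct; it makes a change of predecessor harmless for the subword invariant.
  receive-hist : ∀ {r s s′ S R m j α v old new} → Hist r s S R →
                 Edge {main} {e} (s , rec m j α , s′) → Effect α v old new →
                 ∃[ r′ ] Hist r′ s′ S (emit m ++ R) × RoleReceive m r r′ × j ≡ link ×
                   LinkEffect m v old new × (m ≡ init → R ≡ [])
  receive-hist rooting root-link eff =
    _ , root start , root-link , refl , eff , λ _ → refl
  receive-hist fresh   cell-link eff =
    _ , linked , cell-link , refl , eff , λ _ → refl
  receive-hist (waiting trace eq) (reply eq′ rep) eff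
    with refl ← trans (sym eq) eq′ =
    _ , root (step trace eq rep) , letter , refl , eff , λ ()
  receive-hist (cell trace) tile-in eff =
    _ , mid trace , letter , refl , eff , λ ()

-- The invariant of runs

module _ {main : Prog} {e : ℕ} where
  open Network main e
  open Semantics P

  linkOf : Local → ℕ
  linkOf l = lookup (proj₂ l) link

  record View (l : Local) : Set where
    field
      role          : Role
      state         : St
      sent received : Word
      hist          : Hist {main} {e} role state sent received
      coded         : Coded {main} {e} (proj₁ l) state
  open View

  record Sends (m : Msg) {l l′ : Local} (V : View l) (V′ : View l′) : Set where
    field
      roles     : RoleSend {main} {e} m (role V) (role V′)
      sent≡     : sent V′ ≡ emit m ++ sent V
      received≡ : received V′ ≡ received V

  data Hears (m : Msg) (v : ℕ) {l l′ : Local} (V : View l) (V′ : View l′) : Set where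
    ignores  : role V′ ≡ role V → sent V′ ≡ sent V → received V′ ≡ received V →
               linkOf l′ ≡ linkOf l → Hears m v V V′
    receives : RoleReceive {main} {e} m (role V) (role V′) → sent V′ ≡ sent V →
               received V′ ≡ emit m ++ received V → LinkEffect {main} {e} m v (linkOf l) (linkOf l′) →
               (m ≡ init → received V ≡ []) → Hears m v V V′

  send-view : ∀ {l l′ m i} (V : View l) → (proj₁ l , br m i , proj₁ l′) ∈ Protocol.Δ P →
          ∃[ M ] toℕ m ≡ codeMsg M × i ≡ own × (∃ λ (V′ : View l′) → Sends M V V′)
  send-view V t∈ with decode t∈
  ... | s , br M i , s′ , edge , q≡ , q′≡ , br m≡
    with refl ← codeSt-injective (state V) s (trans (sym (coded V)) q≡)
    with r′ , hist′ , roles , refl ← send-hist (hist V) edge =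
    M , m≡ , refl ,
    record { role = r′ ; state = s′ ; sent = emit M ++ sent V ; received = received V
           ; hist = hist′ ; coded = q′≡ } ,
    record { roles = roles ; sent≡ = refl ; received≡ = refl }

  hear-view : ∀ {l l′ m v} (V : View l) M → toℕ m ≡ codeMsg M → Reception m v l l′ →
          (∃ λ (V′ : View l′) → Hears M v V V′) × lookup (proj₂ l′) own ≡ lookup (proj₂ l) own
  hear-view {l} {l′} {m} V M m≡M reception = go (decode transition)
    where
    open Reception reception
    go : _ → _
    go (s , rec M′ _ _ , s′ , edge , q≡ , q′≡ , rec m≡M′)
      with refl ← codeSt-injective (state V) s (trans (sym (coded V)) q≡)
      with refl ← codeMsg-injective M M′ (trans (sym m≡M) m≡M′)
      with r′ , hist′ , roles , refl , eff , old ← receive-hist (hist V) edge effect =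
      (record { role = r′ ; state = s′ ; sent = sent V ; received = emit M ++ received V
             ; hist = hist′ ; coded = q′≡ } ,
      receives roles refl refl eff old) , others own λ ()

  module _ {n : ℕ} where

    𝔸 : Set
    𝔸 = Fin (suc n)

    -- Inductive, so that the chain of predecessors does lead to a root.
    data Up (id : 𝔸 → ℕ) (role : 𝔸 → Role) (linkTo : 𝔸 → ℕ) : 𝔸 → Set where
      root : ∀ {a} → IsRoot (role a) → Up id role linkTo a
      cell : ∀ {a b} → role a ≡ celled → linkTo a ≡ id b → Up id role linkTo b →
             Up id role linkTo a

    -- Letters may be lost but are read from the linked agent alone, whence `sub`. An `init` comes
    -- only from a new root or from a cell that is itself linked, whence `up`. The chain in `up`
    -- starts at the predecessor, since for a root the chain from itself would be trivial and its
    -- replies come from the agents above it.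
    record Inv (id : 𝔸 → ℕ) (γ : Config 𝔸) : Set where
      field
        view : ∀ a → View (γ a)
        ids  : ∀ a → reg 𝔸 γ a own ≡ id a
        sub  : ∀ a b → linkOf (γ a) ≡ id b → received (view a) ⊆ sent (view b)
        up   : ∀ a → Linked (role (view a)) →
               ∃[ b ] linkOf (γ a) ≡ id b × Up id (role ∘ view) (linkOf ∘ γ) b

    inv-initial : ∀ {γ} → Initial 𝔸 γ → Inv (λ a → reg 𝔸 γ a own) γ
    inv-initial initial = record
      { view = λ a → record
          { role = fresh ; state = start ; sent = [] ; received = [] ; hist = fresh
          ; coded = trans (cong toℕ (Initial.state initial a)) q₀-coded }
      ; ids  = λ a → refl
      ; sub  = λ a b _ → minimum []
      ; up   = λ a ()
      }

    module _ {id : 𝔸 → ℕ} (id-injective : ∀ {a b} → id a ≡ id b → a ≡ b)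
             {γ γ′ : Config 𝔸} (inv : Inv id γ) (s : Step 𝔸 γ γ′) where
      open Inv inv
      open Step s

      private
        sending : ∃[ M ] toℕ m ≡ codeMsg M × i ≡ own × (∃ λ (V′ : View (γ′ a₀)) → Sends M (view a₀) V′)
        sending = send-view (view a₀) transition

        M : Msg
        M = proj₁ sending

        v : ℕ
        v = reg 𝔸 γ a₀ i

        v≡ : v ≡ id a₀
        v≡ = trans (cong (reg 𝔸 γ a₀) (proj₁ (proj₂ (proj₂ sending)))) (ids a₀)

        data Event (a : 𝔸) (V′ : View (γ′ a)) : Set where
          sender : a ≡ a₀ → Sends M (view a) V′ → linkOf (γ′ a) ≡ linkOf (γ a) → Event a V′
          hearer : a ≢ a₀ → Hears M v (view a) V′ → Event a V′

        event : ∀ a → (∃ λ V′ → Event a V′) × reg 𝔸 γ′ a own ≡ reg 𝔸 γ a own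
        event a with a Fin.≟ a₀
        ... | yes refl =
          let V′ , sent = proj₂ (proj₂ (proj₂ sending)) in
          (V′ , sender refl sent (unchanged link)) , unchanged own
        ... | no a≢a₀ with others a a≢a₀
        ...   | inj₁ same =
          (subst View (sym same) (view a) , hearer a≢a₀ (transported same)) ,
          cong (λ l → lookup (proj₂ l) own) same
          where
          transported : ∀ {l l′} {V : View l} (eq : l′ ≡ l) → Hears M v V (subst View (sym eq) V)
          transported refl = ignores refl refl refl refl
        ...   | inj₂ reception =
          let (V′ , heard) , own≡ = hear-view (view a) M (proj₁ (proj₂ sending)) reception in
          (V′ , hearer a≢a₀ heard) , own≡

        view′ : ∀ a → View (γ′ a)
        view′ a = proj₁ (proj₁ (event a))

        event′ : ∀ a → Event a (view′ a)
        event′ a = proj₂ (proj₁ (event a))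

        sent-grows : ∀ a → sent (view a) ⊆ sent (view′ a)
        sent-grows a with event′ a
        ... | sender _ sent _ = subst (_ ⊆_) (sym (Sends.sent≡ sent)) (emit-⊆ M)
          where
          emit-⊆ : ∀ M {w} → w ⊆ emit M ++ w
          emit-⊆ init       = ⊆-refl
          emit-⊆ bye        = ⊆-refl
          emit-⊆ (letter l) = l ∷ʳ ⊆-refl
        ... | hearer _ (ignores _ eq _ _)    = subst (_ ⊆_) (sym eq) ⊆-refl
        ... | hearer _ (receives _ eq _ _ _) = subst (_ ⊆_) (sym eq) ⊆-refl

        sent-a₀ : sent (view′ a₀) ≡ emit M ++ sent (view a₀)
        sent-a₀ with event′ a₀
        ... | sender _ sent _ = Sends.sent≡ sent
        ... | hearer a₀≢a₀ _  = contradiction refl a₀≢a₀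

        same-⊆ : ∀ {a b} → received (view′ a) ≡ received (view a) →
                 linkOf (γ′ a) ≡ linkOf (γ a) → linkOf (γ′ a) ≡ id b →
                 received (view′ a) ⊆ sent (view′ b)
        same-⊆ {a} {b} eq link≡ to =
          subst (_⊆ sent (view′ b)) (sym eq)
            (⊆-trans (sub a b (trans (sym link≡) to)) (sent-grows b))

        -- For `init` nothing has been received yet. For a letter, the equality test and the
        -- injectivity of identities force the sender to be `b`, so both words grow by the same
        -- letter.
        received-⊆ : ∀ {a b} → received (view′ a) ≡ emit M ++ received (view a) →
                     LinkEffect {main} {e} M v (linkOf (γ a)) (linkOf (γ′ a)) →
                     (M ≡ init → received (view a) ≡ []) → linkOf (γ′ a) ≡ id b →
                     received (view′ a) ⊆ sent (view′ b)
        received-⊆ {a} {b} eq eff old to with M | sent-a₀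
        ... | init     | _     = subst (_⊆ sent (view′ b)) (sym (trans eq (old refl))) (minimum _)
        ... | letter l | sent≡
          with refl ← id-injective {b} {a₀}
                        (trans (sym to) (trans (proj₁ eff) (trans (proj₂ eff) v≡))) =
          subst₂ _⊆_ (sym eq) (sym sent≡)
            (refl ∷ sub a a₀ (trans (proj₂ eff) v≡))

        sub′ : ∀ a b → linkOf (γ′ a) ≡ id b → received (view′ a) ⊆ sent (view′ b)
        sub′ a b to with event′ a
        ... | sender _ sent link≡                 = same-⊆ (Sends.received≡ sent) link≡ to
        ... | hearer _ (ignores _ _ eq link≡)     = same-⊆ eq link≡ to
        ... | hearer _ (receives _ _ eq eff old)  = received-⊆ eq eff old to

        root′ : ∀ a → IsRoot (role (view a)) → IsRoot (role (view′ a))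
        root′ a r with event′ a
        ... | hearer _ (ignores eq _ _ _) = subst IsRoot (sym eq) r
        ... | sender _ sent _ = by-send (Sends.roles sent) r
          where
          by-send : ∀ {M r r′} → RoleSend {main} {e} M r r′ → IsRoot r → IsRoot r′
          by-send letter r = r
          by-send bye    r = r
        ... | hearer _ (receives roles _ _ _ _) = by-receive roles r
          where
          by-receive : ∀ {M r r′} → RoleReceive {main} {e} M r r′ → IsRoot r → IsRoot r′
          by-receive root-link _ = rooted
          by-receive letter    r = r

        cell′ : ∀ a → role (view a) ≡ celled →
                role (view′ a) ≡ celled × linkOf (γ′ a) ≡ linkOf (γ a)
        cell′ a r with event′ a
        ... | hearer _ (ignores eq _ _ link≡) = trans eq r , link≡
        ... | sender _ sent link≡ = by-send (Sends.roles sent) r , link≡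
          where
          by-send : ∀ {M r r′} → RoleSend {main} {e} M r r′ → r ≡ celled → r′ ≡ celled
          by-send cell-init r = r
          by-send letter    r = r
          by-send bye       r = r
        ... | hearer _ (receives roles _ _ eff _) = by-receive roles r eff
          where
          by-receive : ∀ {M r r′ v old new} → RoleReceive {main} {e} M r r′ → r ≡ celled →
                       LinkEffect {main} {e} M v old new → r′ ≡ celled × new ≡ old
          by-receive letter r eff = r , proj₁ eff

        Up₁ Up₂ : 𝔸 → Set
        Up₁ = Up id (role ∘ view) (linkOf ∘ γ)
        Up₂ = Up id (role ∘ view′) (linkOf ∘ γ′)

        -- Chains persist, because roots stay roots and cells never change their links.
        up₂ : ∀ {a} → Up₁ a → Up₂ a
        up₂ {a} (root r)       = root (root′ a r)
        up₂ {a} (cell r to up) =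
          let r′ , link≡ = cell′ a r in cell r′ (trans link≡ to) (up₂ up)

        up-a₀ : M ≡ init → Up₂ a₀
        up-a₀ M≡ with event′ a₀ in eq
        ... | hearer a₀≢a₀ _ = contradiction refl a₀≢a₀
        ... | sender _ sent link≡ = go (Sends.roles sent) M≡ refl refl
          where
          go : ∀ {M r r′} → RoleSend {main} {e} M r r′ → M ≡ init →
               r ≡ role (view a₀) → r′ ≡ role (view′ a₀) → Up₂ a₀
          go root-init _ _  r′≡ = root (subst IsRoot r′≡ rooting)
          go cell-init _ r≡ r′≡ =
            let b , to , up-b = up a₀ (subst Linked r≡ celled)
            in cell (sym r′≡) (trans link≡ to) (up₂ up-b)

        keep-up : ∀ {a} → Linked (role (view a)) → linkOf (γ′ a) ≡ linkOf (γ a) →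
                  ∃[ b ] linkOf (γ′ a) ≡ id b × Up₂ b
        keep-up {a} r link≡ = let b , to , up-b = up a r in b , trans link≡ to , up₂ up-b

        up′ : ∀ a → Linked (role (view′ a)) → ∃[ b ] linkOf (γ′ a) ≡ id b × Up₂ b
        up′ a r with event′ a
        ... | hearer _ (ignores eq _ _ link≡) = keep-up (subst Linked eq r) link≡
        ... | sender _ sent link≡ = keep-up (by-send (Sends.roles sent) r) link≡
          where
          by-send : ∀ {M r r′} → RoleSend {main} {e} M r r′ → Linked r′ → Linked r
          by-send cell-init r = r
          by-send letter    r = r
          by-send bye       r = r
        ... | hearer _ (receives roles _ _ eff _) = by-receive roles refl refl eff r
          where
          by-receive : ∀ {M′ r r′} → RoleReceive {main} {e} M′ r r′ → M′ ≡ M →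
                       r ≡ role (view a) → LinkEffect {main} {e} M′ v (linkOf (γ a)) (linkOf (γ′ a)) →
                       Linked r′ → ∃[ b ] linkOf (γ′ a) ≡ id b × Up₂ b
          by-receive root-link M≡ _  eff _ = a₀ , trans eff v≡ , up-a₀ (sym M≡)
          by-receive cell-link M≡ _  eff _ = a₀ , trans eff v≡ , up-a₀ (sym M≡)
          by-receive letter    _  r≡ eff r = keep-up (subst Linked r≡ r) (proj₁ eff)

      inv-step : Inv id γ′
      inv-step = record
        { view = view′
        ; ids  = λ a → trans (proj₂ (event a)) (ids a)
        ; sub  = sub′
        ; up   = up′
        }

    inv-run : ∀ {id} → (∀ {a b} → id a ≡ id b → a ≡ b) →
              ∀ {γ γ′ : Config 𝔸} → Inv id γ → Run 𝔸 γ γ′ → Inv id γ′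
    inv-run inj inv ε        = inv
    inv-run inj inv (s ◅ ss) = inv-run inj (inv-step inj inv s) ss

-- Rows of cells as stores

-- The letter meets the cell at the head of the list first.
data Passes : Letter → List ℕ → Letter → List ℕ → Set where
  []  : ∀ {a} → Passes a [] a []
  _∷_ : ∀ {a b c x y X Y} → pass a x ≡ (b , y) → Passes b X c Y → Passes a (x ∷ X) c (y ∷ Y)

passes-∷ʳ : ∀ {a b c x y X Y} → Passes a X b Y → pass b x ≡ (c , y) →
            Passes a (X ++ x ∷ []) c (Y ++ y ∷ [])
passes-∷ʳ []       eq = eq ∷ []
passes-∷ʳ (p ∷ ps) eq = p ∷ passes-∷ʳ ps eq

passes-ok : ∀ {X c Y} → Passes ok X c Y → c ≡ ok × Y ≡ X
passes-ok []          = refl , refl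
passes-ok (refl ∷ ps) = map₂ (cong (_ ∷_)) (passes-ok ps)

data Swapped (x y : ℕ) (X Y : List ℕ) : Letter → Set where
  done : count x X ≡ suc (count x Y) → count y Y ≡ suc (count y X) →
         (∀ z → z ≢ x → z ≢ y → count z Y ≡ count z X) → Swapped x y X Y ok
  none : count x X ≡ 0 → Y ≡ X → Swapped x y X Y (swap x y)

swapped : ∀ {x y X Y c} → x ≢ y → Passes (swap x y) X c Y → Swapped x y X Y c
swapped x≢y [] = none refl refl
swapped {x} {y} x≢y (_∷_ {x = w} {X = X} p ps) with w ≟ x | p
... | yes refl | refl with passes-ok ps
...   | refl , refl =
  done (trans (count-same x X) (cong suc (sym (count-other X x≢y))))
       (trans (count-same y X) (cong suc (sym (count-other X (x≢y ∘ sym)))))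
       (λ z z≢x z≢y → trans (count-other X z≢y) (sym (count-other X z≢x)))
swapped {x} {y} x≢y (_∷_ {x = w} {X = X} {Y} p ps) | no w≢x | refl with swapped x≢y ps
... | none x∉X eq = none (trans (count-other X (w≢x ∘ sym)) x∉X) (cong (w ∷_) eq)
... | done x≡ y≡ z≡ =
  done (trans (count-other X (w≢x ∘ sym)) (trans x≡ (cong suc (sym (count-other Y (w≢x ∘ sym))))))
       at-y
       (λ z z≢x z≢y → at-z z (z≡ z z≢x z≢y))
  where
  at-y : count y (w ∷ Y) ≡ suc (count y (w ∷ X))
  at-y with y ≟ w
  ... | yes _ = cong suc y≡
  ... | no _  = y≡
  at-z : ∀ z → count z Y ≡ count z X → count z (w ∷ Y) ≡ count z (w ∷ X)
  at-z z eq with z ≟ w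
  ... | yes _ = cong suc eq
  ... | no _  = eq

count-++ : ∀ z X Y → count z (X ++ Y) ≡ count z X + count z Y
count-++ z []      Y = refl
count-++ z (x ∷ X) Y with z ≟ x
... | yes _ = cong suc (count-++ z X Y)
... | no _  = count-++ z X Y

-- Only units are counted, not blanks, so rows of different lengths and with differently ordered
-- cells can represent one store.
Represents : List ℕ → Store → Set
Represents X σ = ∀ r → count (suc r) X ≡ σ r

represents-incr : ∀ {r X Y σ τ} → Represents X σ → Swapped 0 (suc r) X Y ok →
                  τ r ≡ suc (σ r) → (∀ q → q ≢ r → τ q ≡ σ q) → Represents Y τ
represents-incr {r} rep (done _ y≡ z≡) τr τq q with q ≟ r
... | yes refl = trans y≡ (trans (cong suc (rep r)) (sym τr))
... | no q≢r   = trans (z≡ (suc q) (λ ()) (q≢r ∘ suc-injective)) (trans (rep q) (sym (τq q q≢r)))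

represents-decr : ∀ {r X Y σ τ} → Represents X σ → Swapped (suc r) 0 X Y ok →
                  σ r ≡ suc (τ r) → (∀ q → q ≢ r → τ q ≡ σ q) → Represents Y τ
represents-decr {r} rep (done x≡ _ z≡) σr τq q with q ≟ r
... | yes refl = suc-injective (trans (sym x≡) (trans (rep r) σr))
... | no q≢r   = trans (z≡ (suc q) (q≢r ∘ suc-injective) (λ ())) (trans (rep q) (sym (τq q q≢r)))

module _ {main : Prog} {e : ℕ} where
  open Network main e

  -- Swept X u w: a row of cells that has received the word u has sent the
  -- word w, and now contains X.
  data Swept : List ℕ → Word → Word → Set where
    []  : ∀ {u} → Swept [] u u
    snoc : ∀ {x X u v w} → Swept X u v → CellTrace {main} {e} x w v → Swept (X ++ x ∷ []) u w

  swept-nothing : ∀ {X u} → Swept X u [] → Represents X (λ _ → 0)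
  swept-nothing []                  r = refl
  swept-nothing (snoc {X = X} s start) r =
    trans (count-++ (suc r) X (0 ∷ [])) (trans (+-identityʳ _) (swept-nothing s r))

  -- Every cell has sent as many letters as it has received, so the last steps of all cells can be
  -- undone together. They form one passage of the last letter through the whole row.
  swept-step : ∀ {Y a u w} → Swept Y (a ∷ u) w →
               ∃[ X ] ∃[ b ] ∃[ v ] w ≡ b ∷ v × Swept X u v × Passes a X b Y
  swept-step [] = _ , _ , _ , refl , [] , []
  swept-step (snoc s t) with X , b , v , refl , s′ , ps ← swept-step s with t
  ... | step t′ = _ , _ , _ , refl , snoc s′ t′ , passes-∷ʳ ps refl

  -- The roots of the network follow one and the same computation, because each
  -- gets its replies from a row of cells fed by some other such root.
  record Roots (I : Set) : Set where
    field
      control       : I → Ctl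
      sent received : I → Word
      row           : I → List ℕ
      feeder        : I → I
      trace         : ∀ i → RootTrace {main} {e} (control i) (sent i) (received i)
      swept         : ∀ i → Swept (row i) (sent (feeder i)) (received i)

  record LastStep (c : Ctl) (S R : Word) : Set where
    field
      {before} : Ctl
      {instr₀} : Instr Ctl
      {answer} : Letter
      {S₀ R₀}  : Word
      trace₀   : RootTrace {main} {e} before S₀ R₀
      instr≡   : instr before ≡ just instr₀
      reply₀   : Reply instr₀ answer c
      S≡       : S ≡ request instr₀ ∷ S₀
      R≡       : R ≡ answer ∷ R₀

  last-step : ∀ {c S R k} → RootTrace {main} {e} c S R → length R ≡ suc k → LastStep c S R
  last-step (step t eq r) _ = record
    { trace₀ = t ; instr≡ = eq ; reply₀ = r ; S≡ = refl ; R≡ = refl }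

  Reached : Ctl → Store → Set
  Reached c σ = Star (Move instr) (load e , λ _ → 0) (c , σ)

  -- By induction on the common number `k` of replies: undo the last step of all roots and rows at
  -- once. Before it, all controls and stores agreed, so all roots made the same request; and
  -- whether a row serves a request depends only on the store that it represents.
  roots-agree : ∀ k {I} (roots : Roots I) → I → let open Roots roots in
    (∀ i → length (received i) ≡ k) →
    ∃[ c ] ∃[ σ ] Reached c σ × (∀ i → control i ≡ c × Represents (row i) σ)
  roots-agree zero {I} roots i₀ len =
    load e , (λ _ → 0) , ε , λ i → initial (trace i) (len i) , initial-row i
    where
    open Roots roots
    initial : ∀ {c S R} → RootTrace c S R → length R ≡ 0 → c ≡ load e
    initial start _ = refl
    initial-row : ∀ i → Represents (row i) (λ _ → 0)
    initial-row i with received i | len i | swept i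
    ... | [] | refl | s = swept-nothing s
  roots-agree (suc k) {I} roots i₀ len =
    proceed (roots-agree k roots₀ i₀ len₀)
    where
    open Roots roots
    module L (i : I) = LastStep (last-step (trace i) (len i))
    row-step : ∀ i → ∃[ X ] ∃[ b ] ∃[ v ] received i ≡ b ∷ v × Swept X (L.S₀ (feeder i)) v ×
                     Passes (request (L.instr₀ (feeder i))) X b (row i)
    row-step i = swept-step (subst (λ S → Swept (row i) S (received i)) (L.S≡ (feeder i)) (swept i))
    ∷-eqs : ∀ {a b : Letter} {u v} → a ∷ u ≡ b ∷ v → a ≡ b × u ≡ v
    ∷-eqs refl = refl , refl
    answers : ∀ i → L.answer i ≡ proj₁ (proj₂ (row-step i)) ×
                    L.R₀ i ≡ proj₁ (proj₂ (proj₂ (row-step i)))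
    answers i = ∷-eqs (trans (sym (L.R≡ i)) (proj₁ (proj₂ (proj₂ (proj₂ (row-step i))))))
    row₀ : I → List ℕ
    row₀ i = proj₁ (row-step i)
    passes : ∀ i → Passes (request (L.instr₀ (feeder i))) (row₀ i) (L.answer i) (row i)
    passes i = subst (λ b → Passes (request (L.instr₀ (feeder i))) (row₀ i) b (row i)) (sym (proj₁ (answers i)))
                 (proj₂ (proj₂ (proj₂ (proj₂ (proj₂ (row-step i))))))
    roots₀ : Roots I
    roots₀ = record
      { control  = λ i → L.before i
      ; sent     = λ i → L.S₀ i
      ; received = λ i → L.R₀ i
      ; row      = row₀
      ; feeder   = feeder
      ; trace    = λ i → L.trace₀ i
      ; swept    = λ i → subst (Swept (row₀ i) (L.S₀ (feeder i))) (sym (proj₂ (answers i)))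
                           (proj₁ (proj₂ (proj₂ (proj₂ (proj₂ (row-step i))))))
      }
    len₀ : ∀ i → length (L.R₀ i) ≡ k
    len₀ i = suc-injective (trans (cong length (sym (L.R≡ i))) (len i))
    proceed : (∃[ c ] ∃[ σ ] Reached c σ × (∀ i → L.before i ≡ c × Represents (row₀ i) σ)) →
              ∃[ c ] ∃[ σ ] Reached c σ × (∀ i → control i ≡ c × Represents (row i) σ)
    proceed (c , σ , reached , agree) = by-instr (L.instr₀ i₀) refl
      where
      c≡ : ∀ i → instr c ≡ just (L.instr₀ i)
      c≡ i = trans (cong instr (sym (proj₁ (agree i)))) (L.instr≡ i)
      same : ∀ {ins} → L.instr₀ i₀ ≡ ins → ∀ i → L.instr₀ i ≡ ins
      same eq i = trans (just-injective (trans (sym (c≡ i)) (c≡ i₀))) eq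
      data Outcome (ins : Instr Ctl) (i : I) : Set where
        outcome : ∀ {l} → Reply ins l (control i) →
                  Passes (request ins) (row₀ i) l (row i) → Outcome ins i
      outcomes : ∀ {ins} → L.instr₀ i₀ ≡ ins → ∀ i → Outcome ins i
      outcomes eq i =
        outcome (subst (λ ins → Reply ins (L.answer i) (control i)) (same eq i) (L.reply₀ i))
                -- The letter that crosses the row of `i` was requested by `feeder i`, not by `i`;
                -- it is the right request because all instructions coincide.
                (subst (λ ins → Passes (request ins) (row₀ i) (L.answer i) (row i)) (same eq (feeder i)) (passes i))
      by-instr : ∀ ins → L.instr₀ i₀ ≡ ins →
                 ∃[ c ] ∃[ σ ] Reached c σ × (∀ i → control i ≡ c × Represents (row i) σ)
      by-instr (incr r c′) eq =
        c′ , σ [ r ≔ suc (σ r) ] ,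
        reached ◅◅ incr (trans (c≡ i₀) (cong just eq)) (≔-same σ r _) (≔-other σ r _) ◅ ε ,
        λ i → result i (outcomes eq i)
        where
        result : ∀ i → Outcome (incr r c′) i →
                 control i ≡ c′ × Represents (row i) (σ [ r ≔ suc (σ r) ])
        result i (outcome incr ps) = refl , represents-incr (proj₂ (agree i)) (swapped (λ ()) ps) (≔-same σ r _) (≔-other σ r _)
      by-instr (decr r c′ c₀) eq with σ r in σr
      ... | suc n =
        c′ , σ [ r ≔ n ] ,
        reached ◅◅ decr (trans (c≡ i₀) (cong just eq))
                        (trans σr (cong suc (sym (≔-same σ r n)))) (≔-other σ r _) ◅ ε ,
        λ i → result i (outcomes eq i)
        where
        result : ∀ i → Outcome (decr r c′ c₀) i →
                 control i ≡ c′ × Represents (row i) (σ [ r ≔ n ])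
        result i (outcome decr ps) =
          refl , represents-decr (proj₂ (agree i)) (swapped (λ ()) ps)
                   (trans σr (cong suc (sym (≔-same σ r n)))) (≔-other σ r n)
        result i (outcome none ps) with swapped (λ ()) ps
        ... | none x∉ _ with () ← trans (sym σr) (trans (sym (proj₂ (agree i) r)) x∉)
      ... | zero =
        c₀ , σ , reached ◅◅ none (trans (c≡ i₀) (cong just eq)) σr (λ _ → refl) ◅ ε ,
        λ i → result i (outcomes eq i)
        where
        result : ∀ i → Outcome (decr r c′ c₀) i → control i ≡ c₀ × Represents (row i) σ
        result i (outcome none ps) with swapped (λ ()) ps
        ... | none _ row≡ = refl , subst (λ X → Represents X σ) (sym row≡) (proj₂ (agree i))
        result i (outcome decr ps) with swapped (λ ()) ps
        ... | done x≡ _ _ with () ← trans (sym x≡) (trans (proj₂ (agree i) r) σr)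

trace-lengths : ∀ {main e c S R} → RootTrace {main} {e} c S R → length S ≡ length R
trace-lengths start        = refl
trace-lengths (step t _ _) = cong suc (trace-lengths t)

cell-lengths : ∀ {main e x S R} → CellTrace {main} {e} x S R → length S ≡ length R
cell-lengths start    = refl
cell-lengths {main} {e} (step t) = cong suc (cell-lengths {main} {e} t)

⊆-length⇒≡ : ∀ {A : Set} {u w : List A} → u ⊆ w → length u ≡ length w → u ≡ w
⊆-length⇒≡ u⊆w eq = Pointwise-≡⇒≡ (toPointwise eq u⊆w)

maximum : ∀ {n} (f : Fin (suc n) → ℕ) → ∃[ a ] (∀ b → f b ≤ f a)
maximum {zero}  f = zero , λ { zero → ≤-refl }
maximum {suc n} f with maximum (f ∘ suc)
... | a , max with ≤-total (f zero) (f (suc a))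
...   | inj₁ le = suc a , λ { zero → le ; (suc b) → max b }
...   | inj₂ ge = zero , λ { zero → ≤-refl ; (suc b) → ≤-trans (max b) ge }

-- Agents that send a longest word

module _ {main : Prog} {e : ℕ} where
  open Network main e
  open Semantics P

  module _ {n : ℕ} {id : Fin (suc n) → ℕ} {γ : Config (Fin (suc n))} (inv : Inv {main} {e} id γ)
           (final : ∀ a → st (Fin (suc n)) γ a ≡ qf) where
    open Inv inv

    private
      module V (a : Fin (suc n)) = View (view a)

    data Finished (r : Role) (S R : Word) : Set where
      root : r ≡ rooted → RootTrace {main} {e} (run end) S R → Finished r S R
      cell : ∀ {x} → r ≡ celled → CellTrace {main} {e} x S R → Finished r S R

    finished : ∀ a → Finished (V.role a) (V.sent a) (V.received a)
    finished a = by-hist (V.hist a)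
      (codeSt-injective _ _ (trans (sym (V.coded a)) (trans (cong toℕ (final a)) qf-coded)))
      where
      by-hist : ∀ {r s S R} → Hist {main} {e} r s S R → s ≡ ctl (run end) → Finished r S R
      by-hist (root t) refl = root refl t
      by-hist (left t) _    = cell refl t

    -- The target state excludes waiting roots and cells in `mid`, the only agents whose words
    -- differ in length.
    lengths : ∀ a → length (V.sent a) ≡ length (V.received a)
    lengths a with finished a
    ... | root _ t = trace-lengths t
    ... | cell _ t = cell-lengths {main} {e} t

    linked-final : ∀ a → Linked (V.role a)
    linked-final a with finished a
    ... | root eq _ = subst Linked (sym eq) rooted
    ... | cell eq _ = subst Linked (sym eq) celled

    longest : Fin (suc n)
    longest = proj₁ (maximum (length ∘ V.sent))

    Good : Fin (suc n) → Set
    Good a = length (V.sent a) ≡ length (V.sent longest)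

    -- Of the agents that send a longest word, no letter of the predecessor is
    -- lost: the predecessor would have to send an even longer word.
    good-link : ∀ {a b} → Good a → linkOf (γ a) ≡ id b → V.received a ≡ V.sent b × Good b
    good-link {a} {b} good to = ⊆-length⇒≡ (sub a b to) (trans (sym good-R) (sym good-b)) , good-b
      where
      good-R : length (V.sent longest) ≡ length (V.received a)
      good-R = trans (sym good) (lengths a)
      good-b : Good b
      good-b = ≤-antisym (proj₂ (maximum (length ∘ V.sent)) b)
        (subst (_≤ length (V.sent b)) (sym good-R) (length-mono-≤ (sub a b to)))

    GoodRoot : Set
    GoodRoot = ∃[ a ] Good a × RootTrace {main} {e} (run end) (V.sent a) (V.received a)

    sent-by : GoodRoot → Word
    sent-by (a , _) = V.sent a

    -- Climb from `b` to a root along `Up`, which is well-founded. Goodness passes from each agent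
    -- to its predecessor, so the words fit together without gaps and the root reached is good as
    -- well.
    row-above : ∀ {b} → Up {main} {e} id V.role (linkOf ∘ γ) b → Good b →
                ∃[ ρ ] ∃[ X ] Swept {main} {e} X (sent-by ρ) (V.sent b)
    row-above {b} (root r) good with finished b
    ... | root _ t = (b , good , t) , [] , []
    ... | cell eq _ with () ← subst IsRoot eq r
    row-above {b} (cell r to up) good with finished b
    ... | root eq _ with () ← trans (sym eq) r
    ... | cell {x} _ t with received≡ , good′ ← good-link good to
      with ρ , X , s ← row-above up good′ =
      ρ , X ++ x ∷ [] , snoc s (subst (CellTrace {main} {e} x (V.sent b)) received≡ t)

    feed : ∀ (ρ : GoodRoot) → ∃[ ρ′ ] ∃[ X ] Swept {main} {e} X (sent-by ρ′) (V.received (proj₁ ρ))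
    feed (a , good , t) =
      let b , to , up-b = up a (linked-final a)
          received≡ , good-b = good-link good to
          ρ , X , s = row-above up-b good-b
      in ρ , X , subst (Swept {main} {e} X (sent-by ρ)) (sym received≡) s

    -- The agent `longest` may be a cell; a root is found by climbing from its predecessor.
    good-root : GoodRoot
    good-root =
      let b , to , up-b = up longest (linked-final longest)
      in proj₁ (row-above up-b (proj₂ (good-link refl to)))

    good-roots : Roots {main} {e} GoodRoot
    good-roots = record
      { control  = λ _ → run end
      ; sent     = sent-by
      ; received = λ (a , _) → V.received a
      ; row      = λ ρ → proj₁ (proj₂ (feed ρ))
      ; feeder   = λ ρ → proj₁ (feed ρ)
      ; trace    = λ (_ , _ , t) → t
      ; swept    = λ ρ → proj₂ (proj₂ (feed ρ))
      }

    machine-ends : ∃[ σ ] Star (Move instr) (load e , λ _ → 0) (run end , σ)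
    machine-ends =
      let c , σ , reached , agree = roots-agree (length (V.sent longest)) good-roots good-root
                                      (λ (a , good , _) → trans (sym (lengths a)) good)
      in σ , subst (λ c → Star (Move instr) (load e , λ _ → 0) (c , σ))
                   (sym (proj₁ (agree good-root))) reached

  target⇒ends : Target (P , qf) → ∃[ σ ] Star (Move instr) (load e , λ _ → 0) (run end , σ)
  target⇒ends (n , γ₀ , γf , initial , steps , final) =
    machine-ends (inv-run injective (inv-initial initial) steps) final
    where
    injective : ∀ {a b} → reg (Fin (suc n)) γ₀ a own ≡ reg (Fin (suc n)) γ₀ b own → a ≡ b
    injective {a} {b} eq with a Fin.≟ b
    ... | yes a≡b = a≡b
    ... | no a≢b  =
      contradiction eq (Initial.distinct initial a own b own (a≢b ∘ cong proj₁))

-- Completeness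

Next : ∀ {C : Set} → (C → Set) → Instr C → Set
Next Q (incr r c)    = Q c
Next Q (decr r c c₀) = Q c × Q c₀

module _ (main : Prog) where

  -- A reachable program is a piece of `main` followed by a continuation of the same kind. Entering
  -- a loop body pushes the loop as a continuation, and an exhausted piece is popped.
  data Positioned : Prog → Set where
    end : Positioned end
    at  : ∀ p {k κ} → κ ≡ p ▷ k → (∀ {q} → q ∈ positions p k → q ∈ positions main end) →
          Positioned k → Positioned κ

  positioned-next : ∀ {κ ins} → Positioned κ → progInstr κ ≡ just ins →
                    κ ∈ positions main end × Next Positioned ins
  positioned-next (at end          refl sub k) eq   = positioned-next k eq
  positioned-next (at (inc r p)    refl sub k) refl = sub (here refl) , at p refl (sub ∘ there) k
  positioned-next (at (loop r b p) refl sub k) refl =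
    sub (here refl) ,
    at b refl (sub ∘ there ∘ ∈-++⁺ˡ) (at (loop r b p) refl sub k) ,
    at p refl (sub ∘ there ∘ ∈-++⁺ʳ (positions b _)) k

module _ {main : Prog} {e : ℕ} where
  open Network main e

  opaque
    unfolding Δ

    link∈ : (root₁ , rec init link ↓ , ctl (load e)) ∈ Δ
    link∈ = here refl

    load⊆ : ∀ {t} → t ∈ loadEdges e → t ∈ Δ
    load⊆ = there ∘ ∈-++⁺ˡ

    cell-link∈ : (start , rec init link ↓ , linked) ∈ Δ
    cell-link∈ = there (∈-++⁺ʳ (loadEdges e) (there (here refl)))

    cell-init∈ : (linked , br init own , cell 0) ∈ Δ
    cell-init∈ = there (∈-++⁺ʳ (loadEdges e) (there (there (here refl))))

    fixed⊆ : ∀ {t} → t ∈ fixed → t ∈ Δ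
    fixed⊆ = there ∘ ∈-++⁺ʳ (loadEdges e)

  data Reachable : Ctl → Set where
    load : ∀ {j} → j ≤ e → Reachable (load j)
    run  : ∀ {p} → Positioned main p → Reachable (run p)

  load∈ : ∀ {j n t} → suc j ≤ n → t ∈ rootEdges (load (suc j)) (incr 0 (load j)) → t ∈ loadEdges n
  load∈ {j} {suc n} j<n t∈ with j ≟ n
  ... | yes refl = ∈-++⁺ˡ t∈
  ... | no j≢n   = ∈-++⁺ʳ (rootEdges (load (suc n)) (incr 0 (load n)))
                     (load∈ (≤∧≢⇒< (s≤s⁻¹ j<n) j≢n) t∈)

  Serves : Ctl → Instr Ctl → Set
  Serves c ins = (∀ {t} → t ∈ rootEdges c ins → t ∈ Δ) × suc (register ins) ∈ contents

  ctl-serves : ∀ {c ins} → c ∈ ctls → instr c ≡ just ins → Serves c ins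
  ctl-serves {c} {ins} c∈ eq =
    (λ t∈ → fixed⊆ (there (there (there (∈-++⁺ʳ (map leaveEdge contents) (∈-++⁺ˡ
              (∈-concatMap ctlEdges c∈ (subst (λ i → _ ∈ maybe′ (rootEdges c) [] i) (sym eq) t∈)))))))) ,
    there (there (subst (_∈ map content ctls) (cong (suc ∘ maybe′ register 0) eq)
      (∈-map⁺ content c∈)))

  reachable-next : ∀ {c ins} → Reachable c → instr c ≡ just ins → Serves c ins × Next Reachable ins
  reachable-next {load zero}    (load _) refl =
    ctl-serves (here refl) refl , run (at main (sym (▷-end main)) id end)
    where
    ▷-end : ∀ p → p ▷ end ≡ p
    ▷-end end          = refl
    ▷-end stuck        = refl
    ▷-end (inc r p)    = cong (inc r) (▷-end p)
    ▷-end (loop r b p) = cong (loop r b) (▷-end p)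
  reachable-next {load (suc j)} (load j<e) refl =
    (load⊆ ∘ load∈ j<e , there (here refl)) , load (<⇒≤ j<e)
  reachable-next {run p} (run pos) eq with progInstr p in eq′ | eq
  ... | just ins | refl =
    let p∈ , next = positioned-next main pos eq′ in
    ctl-serves (there (∈-map⁺ run p∈)) (cong (Maybe.map (mapInstr run)) eq′) , lift-next ins next
    where
    lift-next : ∀ ins → Next (Positioned main) ins → Next Reachable (mapInstr run ins)
    lift-next (incr r c)    pos          = run pos
    lift-next (decr r c c₀) (pos , pos₀) = run pos , run pos₀

  data Known : Letter → Set where
    ok   : Known ok
    swap : ∀ {x y} → x ∈ contents → y ∈ contents → Known (swap x y)

  known∈ : ∀ {l} → Known l → l ∈ letters
  known∈ ok           = here refl
  known∈ (swap x∈ y∈) = there (∈-concatMap (λ x → map (swap x) contents) x∈ (∈-map⁺ (swap _) y∈))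

  pass-known : ∀ {l x b y} → Known l → x ∈ contents → pass l x ≡ (b , y) → Known b × y ∈ contents
  pass-known ok x∈ refl = ok , x∈
  pass-known {swap x y} {z} (swap x∈ y∈) z∈ eq with z ≟ x | eq
  ... | yes _ | refl = ok , y∈
  ... | no _  | refl = swap x∈ y∈ , z∈

  pass∈ : ∀ {l x t} → Known l → x ∈ contents → t ∈ passEdges x l → t ∈ Δ
  pass∈ l∈ x∈ t∈ = fixed⊆ (there (there (there (∈-++⁺ʳ (map leaveEdge contents)
    (∈-++⁺ʳ (concatMap ctlEdges ctls) (∈-concatMap (λ x → concatMap (passEdges x) letters) x∈ (∈-concatMap (passEdges _) (known∈ l∈) t∈)))))))

  tile-in∈ : ∀ {l x b y} → Known l → x ∈ contents → pass l x ≡ (b , y) →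
             (cell x , rec (letter l) link == , mid b y) ∈ Δ
  tile-in∈ l∈ x∈ refl = pass∈ l∈ x∈ (here refl)

  tile-out∈ : ∀ {l x b y} → Known l → x ∈ contents → pass l x ≡ (b , y) →
              (mid b y , br (letter b) own , cell y) ∈ Δ
  tile-out∈ l∈ x∈ refl = pass∈ l∈ x∈ (there (here refl))

  leave-from∈ : ∀ {x} → x ∈ contents → leaveEdge x ∈ Δ
  leave-from∈ x∈ = fixed⊆ (there (there (there (∈-++⁺ˡ (∈-map⁺ leaveEdge x∈)))))

  request-known : ∀ (ins : Instr Ctl) → suc (register ins) ∈ contents → Known (request ins)
  request-known (incr r c)    r∈ = swap (here refl) r∈
  request-known (decr r c c₀) r∈ = swap r∈ (here refl)

  request∈ : ∀ {c ins} → Serves c ins → (ctl c , br (letter (request ins)) own , wait c) ∈ Δ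
  request∈ {ins = incr r c}    (edges , _) = edges (here refl)
  request∈ {ins = decr r c c₀} (edges , _) = edges (here refl)

  reply∈ : ∀ {c ins l c′} → Serves c ins → Reply ins l c′ →
           (wait c , rec (letter l) link == , ctl c′) ∈ Δ
  reply∈ (edges , _) incr = edges (there (here refl))
  reply∈ (edges , _) decr = edges (there (here refl))
  reply∈ (edges , _) none = edges (there (there (here refl)))

-- Runs of a ring

module _ {main : Prog} {e : ℕ} where
  open Network main e
  open Semantics P

  -- State, own identity, and link of an agent.
  Entry : Set
  Entry = St × ℕ × ℕ

  local : Entry → Local
  local (s , o , l) = clampSt s , o ∷ l ∷ []

  -- Past the end, the default entry is in the state qf, which spares a bound in gone-final.
  at-index : List Entry → ℕ → Entry
  at-index []       i       = ctl (run end) , 0 , 0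
  at-index (x ∷ xs) zero    = x
  at-index (x ∷ xs) (suc i) = at-index xs i

  data Reacts (m : Msg) (v : ℕ) : Entry → Entry → Set where
    ignores : ∀ {x} → Reacts m v x x
    hears   : ∀ {s s′ o l l′} α → (s , rec m link α , s′) ∈ Δ → Effect α v l l′ →
              Reacts m v (s , o , l) (s′ , o , l′)

  data React (m : Msg) (v : ℕ) : List Entry → List Entry → Set where
    none : ∀ {xs} → React m v xs xs
    head : ∀ {x x′ xs} → Reacts m v x x′ → React m v (x ∷ xs) (x′ ∷ xs)

  -- Besides the sender, only its right neighbour and agents to its left may react. This covers the
  -- ring, where a cell hands a letter to the next cell and the last cell answers the root at the
  -- front.
  data Sending (m : Msg) (v : ℕ) : List Entry → List Entry → Set where
    here  : ∀ {s s′ l xs xs′} → (s , br m own , s′) ∈ Δ → React m v xs xs′ →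
            Sending m v ((s , v , l) ∷ xs) ((s′ , v , l) ∷ xs′)
    there : ∀ {x x′ xs xs′} → Reacts m v x x′ → Sending m v xs xs′ →
            Sending m v (x ∷ xs) (x′ ∷ xs′)

  react-at : ∀ {m v xs xs′} → React m v xs xs′ → ∀ i → Reacts m v (at-index xs i) (at-index xs′ i)
  react-at none     i       = ignores
  react-at (head r) zero    = r
  react-at (head r) (suc i) = ignores

  react-length : ∀ {m v xs xs′} → React m v xs xs′ → length xs′ ≡ length xs
  react-length none     = refl
  react-length (head r) = refl

  sending-length : ∀ {m v xs xs′} → Sending m v xs xs′ → length xs′ ≡ length xs
  sending-length (here t r)  = cong suc (react-length r)
  sending-length (there r s) = cong suc (sending-length s)

  record SenderAt (m : Msg) (v : ℕ) (xs xs′ : List Entry) : Set where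
    field
      index   : ℕ
      index<  : index < length xs
      {s s′}  : St
      {l}     : ℕ
      before  : at-index xs index ≡ (s , v , l)
      after   : at-index xs′ index ≡ (s′ , v , l)
      t∈Δ     : (s , br m own , s′) ∈ Δ
      others  : ∀ i → i ≢ index → Reacts m v (at-index xs i) (at-index xs′ i)

  sender-at : ∀ {m v xs xs′} → Sending m v xs xs′ → SenderAt m v xs xs′
  sender-at (here t r) = record
    { index = 0 ; index< = s≤s z≤n ; before = refl ; after = refl ; t∈Δ = t
    ; others = λ { zero 0≢0 → contradiction refl 0≢0 ; (suc i) _ → react-at r i } }
  sender-at (there r s) = record
    { index = suc index ; index< = s≤s index< ; before = before ; after = after ; t∈Δ = t∈Δ
    ; others = λ { zero _ → r ; (suc i) i≢ → others i (i≢ ∘ cong suc) } }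
    where open SenderAt (sender-at s)

  config : ∀ {n} → List Entry → Config (Fin (suc n))
  config xs a = local (at-index xs (toℕ a))

  reacts⇒reception : ∀ {m v x x′} → Reacts m v x x′ →
    local x′ ≡ local x ⊎ Reception (clampMsg m) v (local x) (local x′)
  reacts⇒reception ignores         = inj₁ refl
  reacts⇒reception (hears α t eff) = inj₂ record
    { j = link ; α = α ; transition = encode t
    ; others = λ { zero _ → refl ; (suc zero) link≢link → contradiction refl link≢link }
    ; effect = eff }

  sending⇒step : ∀ {n m v xs xs′} → length xs ≡ suc n → Sending m v xs xs′ →
                 Step (Fin (suc n)) (config xs) (config xs′)
  sending⇒step {n} {m} {v} {xs} {xs′} len sending = record
    { m = clampMsg m ; a₀ = a₀ ; i = own
    ; transition = subst₂ (λ x x′ → (proj₁ (local x) , br (clampMsg m) own , proj₁ (local x′))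
                                      ∈ Protocol.Δ P)
                     (sym before₀) (sym after₀) (encode t∈Δ)
    ; unchanged = λ j → trans (cong (λ x → lookup (proj₂ (local x)) j) after₀)
                          (sym (cong (λ x → lookup (proj₂ (local x)) j) before₀))
    ; others = λ a a≢a₀ →
        subst (λ v → config xs′ a ≡ config xs a ⊎
                     Reception (clampMsg m) v (config xs a) (config xs′ a))
          (sym (cong (proj₁ ∘ proj₂) before₀))
          (reacts⇒reception (others (toℕ a)
            (λ eq → a≢a₀ (toℕ-injective (trans eq (sym index≡)))))) }
    where
    open SenderAt (sender-at sending)
    a₀ : Fin (suc n)
    a₀ = fromℕ< (subst (index <_) len index<)
    index≡ : toℕ a₀ ≡ index
    index≡ = toℕ-fromℕ< _
    before₀ : at-index xs (toℕ a₀) ≡ (s , v , l)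
    before₀ = trans (cong (at-index xs) index≡) before
    after₀ : at-index xs′ (toℕ a₀) ≡ (s′ , v , l)
    after₀ = trans (cong (at-index xs′) index≡) after

  -- The pairs consist of the root and the list of cells of a ring.
  data CellStep : Entry × List Entry → Entry × List Entry → Set where
    cell-step : ∀ {m v ρ ρ′ xs xs′} → Reacts m v ρ ρ′ → Sending m v xs xs′ →
                CellStep (ρ , xs) (ρ′ , xs′)

  infix 4 _⇒*_

  _⇒*_ : Entry × List Entry → Entry × List Entry → Set
  _⇒*_ = Star CellStep

  extend : ∀ {x ρ ρ′ xs xs′} → (ρ , xs) ⇒* (ρ′ , xs′) → (ρ , x ∷ xs) ⇒* (ρ′ , x ∷ xs′)
  extend {x} = gmap (map₂ (x ∷_)) λ { (cell-step r s) → cell-step r (there ignores s) }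

  cell-steps⇒run : ∀ {n ρ ρ′ xs xs′} → length xs ≡ n → (ρ , xs) ⇒* (ρ′ , xs′) →
                   Run (Fin (suc n)) (config (ρ ∷ xs)) (config (ρ′ ∷ xs′)) × length xs′ ≡ n
  cell-steps⇒run len ε = ε , len
  cell-steps⇒run len (cell-step r s ◅ ss) =
    let steps , len′ = cell-steps⇒run (trans (sending-length s) len) ss
    in sending⇒step (cong suc len) (there r s) ◅ steps , len′

  -- k is the identity of the predecessor of the first cell.
  cells : ℕ → List ℕ → List Entry
  cells k []      = []
  cells k (x ∷ X) = (cell x , suc k , k) ∷ cells (suc k) X

  -- With `N` agents numbered from 0, the offset `N` keeps the initial links apart from the
  -- identities.
  newborn : ℕ → ℕ → ℕ → List Entry
  newborn N k zero    = []
  newborn N k (suc n) = (start , k , N + k) ∷ newborn N (suc k) n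

  gone : ℕ → List ℕ → List Entry
  gone k []      = []
  gone k (x ∷ X) = (ctl (run end) , suc k , k) ∷ gone (suc k) X

  -- The `init` messages travel down the row, each accepted by the next agent only. The root ignores
  -- all but the last one, so its link becomes `N`, the identity of the last cell, and the ring
  -- closes.
  init-cells : ∀ {N l} M k n → suc k + n ≡ N →
    ((root₁ , 0 , l) , (linked , suc k , k) ∷ newborn M (2 + k) n) ⇒*
    ((ctl (load e) , 0 , N) , (cell 0 , suc k , k) ∷ cells (suc k) (replicate n 0))
  init-cells M k zero    refl =
    cell-step (hears ↓ link∈ (+-identityʳ (suc k))) (here cell-init∈ none) ◅ ε
  init-cells M k (suc n) eq   =
    cell-step ignores (here cell-init∈ (head (hears ↓ cell-link∈ refl))) ◅
    extend (init-cells M (suc k) n (trans (sym (+-suc (suc k) n)) eq))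

  -- Each broadcast of a cell is at once the reception of the next one, so the letter crosses the
  -- row one cell at a time; the last broadcast is the reply to the root.
  sweep : ∀ {N c₀ c′ a b c k x y X Y} → suc k + length X ≡ N →
    Known {main} {e} a → x ∈ contents → All (_∈ contents) X →
    pass a x ≡ (b , y) → Passes b X c Y → (wait c₀ , rec (letter c) link == , ctl c′) ∈ Δ →
    ((wait c₀ , 0 , N) , (mid b y , suc k , k) ∷ cells (suc k) X) ⇒*
    ((ctl c′ , 0 , N) , (cell y , suc k , k) ∷ cells (suc k) Y)
  sweep {k = k} len known x∈ [] eq [] back =
    cell-step (hears == back (refl , trans (sym len) (+-identityʳ (suc k))))
              (here (tile-out∈ known x∈ eq) none) ◅ ε
  sweep {k = k} {X = _ ∷ X} len known x∈ (x′∈ ∷ X∈) eq (p ∷ ps) back =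
    let known′ = proj₁ (pass-known {main} {e} known x∈ eq) in
    cell-step ignores (here (tile-out∈ known x∈ eq)
                        (head (hears == (tile-in∈ known′ x′∈ p) (refl , refl)))) ◅
    extend (sweep (trans (sym (+-suc (suc k) (length X))) len) known′ x′∈ X∈ p ps back)

  leave-cells : ∀ {ρ k X} → All (_∈ contents) X → (ρ , cells k X) ⇒* (ρ , gone k X)
  leave-cells []        = ε
  leave-cells (x∈ ∷ X∈) =
    cell-step ignores (here (leave-from∈ x∈) none) ◅ extend (leave-cells X∈)

-- Simulation of a halting computation by a ring

passes-total : ∀ a X → ∃[ c ] ∃[ Y ] Passes a X c Y
passes-total a []      = a , [] , []
passes-total a (x ∷ X) =
  let c , Y , ps = passes-total (proj₁ (pass a x)) X in c , proj₂ (pass a x) ∷ Y , refl ∷ ps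

passes-length : ∀ {a X c Y} → Passes a X c Y → length Y ≡ length X
passes-length []       = refl
passes-length (_ ∷ ps) = cong suc (passes-length ps)

count-replicate : ∀ q n → count q (replicate n q) ≡ n
count-replicate q zero    = refl
count-replicate q (suc n) = trans (count-same q (replicate n q)) (cong suc (count-replicate q n))

represents-blank : ∀ n → Represents (replicate n 0) (λ _ → 0)
represents-blank zero    r = refl
represents-blank (suc n) r = represents-blank n r

moves : ∀ {A : Set} {R : A → A → Set} {x y} → Star R x y → ℕ
moves ε        = 0
moves (_ ◅ ms) = suc (moves ms)

module _ {main : Prog} {e : ℕ} where
  open Network main e
  open Semantics P

  Row : ℕ → List ℕ → Set
  Row N X = length X ≡ suc N × All (_∈ contents) X

  passes-known : ∀ {a X c Y} → Known {main} {e} a → All (_∈ contents) X → Passes a X c Y →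
                 All (_∈ contents) Y
  passes-known known []        []       = []
  passes-known {a} known (x∈ ∷ X∈) (_∷_ {x = x} p ps) =
    let known′ , y∈ = pass-known {main} {e} {a} {x} known x∈ p in y∈ ∷ passes-known known′ X∈ ps

  cells-length : ∀ k X → length (cells {main} {e} k X) ≡ length X
  cells-length k []      = refl
  cells-length k (x ∷ X) = cong suc (cells-length (suc k) X)

  ring : ℕ → Ctl → List ℕ → List (Entry {main} {e})
  ring N c X = (ctl c , 0 , suc N) ∷ cells {main} {e} 0 X

  RunsTo : ℕ → List (Entry {main} {e}) → List (Entry {main} {e}) → Set
  RunsTo N xs xs′ = Run (Fin (2 + N)) (config {main} {e} xs) (config {main} {e} xs′)

  round : ∀ {N c ins l c′ X Y} → Reachable {main} {e} c → instr c ≡ just ins → Reply ins l c′ →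
          Row N X → Passes (request ins) X l Y → RunsTo N (ring N c X) (ring N c′ Y) × Row N Y
  round {N} {ins = ins} {X = x ∷ X} {Y} reach eq rep (len , x∈ ∷ X∈) (p ∷ ps) =
    sending⇒step {main} {e} (cong suc (trans (cells-length 0 (x ∷ X)) len))
      (here (request∈ {main} {e} serves)
            (head (hears == (tile-in∈ {main} {e} known x∈ p) (refl , refl)))) ◅
    proj₁ (cell-steps⇒run {main} {e}
      (trans (cong suc (cells-length 1 X)) len)
      (sweep {main} {e} len known x∈ X∈ p ps (reply∈ {main} {e} serves rep))) ,
    trans (passes-length {request ins} {x ∷ X} (p ∷ ps)) len , passes-known {request ins} {x ∷ X} known (x∈ ∷ X∈) (p ∷ ps)
    where
    serves : Serves {main} {e} _ _
    serves = proj₁ (reachable-next {main} {e} reach eq)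
    known : Known {main} {e} (request ins)
    known = request-known {main} {e} ins (proj₂ serves)

  -- Each move uses up at most one blank cell. Hence having as many blanks as moves left is
  -- preserved, and every increment finds a blank.
  simulate : ∀ {N c d σ τ X} (ms : Star (Move instr) (c , σ) (d , τ)) →
             Reachable {main} {e} c → Row N X → Represents X σ → moves ms ≤ count 0 X →
             ∃[ Y ] RunsTo N (ring N c X) (ring N d Y) × Row N Y
  simulate ε reach row rep le = _ , ε , row
  simulate {X = X} (incr {r = r} eq τr τq ◅ ms) reach row rep le
    with l , Y , ps ← passes-total (swap 0 (suc r)) X
    with swapped (λ ()) ps
  ... | none blank _ with () ← subst (suc (moves ms) ≤_) blank le
  ... | done x≡ y≡ z≡ =
    let run₁ , row′ = round reach eq incr row ps
        Y , run₂ , row″ = simulate ms (proj₂ (reachable-next {main} {e} reach eq)) row′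
                            (represents-incr {X = X} {Y} rep (done x≡ y≡ z≡) τr τq)
                            (s≤s⁻¹ (subst (suc (moves ms) ≤_) x≡ le))
    in Y , run₁ ◅◅ run₂ , row″
  simulate {X = X} (decr {r = r} eq σr τq ◅ ms) reach row rep le
    with l , Y , ps ← passes-total (swap (suc r) 0) X
    with swapped (λ ()) ps
  ... | none x∉ _ with () ← trans (sym σr) (trans (sym (rep r)) x∉)
  ... | done x≡ y≡ z≡ =
    let run₁ , row′ = round reach eq decr row ps
        Y , run₂ , row″ = simulate ms (proj₁ (proj₂ (reachable-next {main} {e} reach eq))) row′
                            (represents-decr {X = X} {Y} rep (done x≡ y≡ z≡) σr τq)
                            (≤-trans (n≤1+n _) (≤-trans le (≤-trans (n≤1+n _) (≤-reflexive (sym y≡)))))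
    in Y , run₁ ◅◅ run₂ , row″
  simulate {X = X} (none {r = r} eq σr τq ◅ ms) reach row rep le
    with l , Y , ps ← passes-total (swap (suc r) 0) X
    with swapped (λ ()) ps
  ... | done x≡ _ _ with () ← trans (sym x≡) (trans (rep r) σr)
  ... | none _ refl =
    let run₁ , row′ = round reach eq none row ps
        Y , run₂ , row″ = simulate ms (proj₂ (proj₂ (reachable-next {main} {e} reach eq))) row′
                            (λ q → trans (rep q) (sym (τq q))) (≤-trans (n≤1+n _) le)
    in Y , run₁ ◅◅ run₂ , row″

  newborn-length : ∀ M k n → length (newborn {main} {e} M k n) ≡ n
  newborn-length M k zero    = refl
  newborn-length M k (suc n) = cong suc (newborn-length M (suc k) n)

  newborn-at : ∀ M k n i → i < n →
               at-index {main} {e} (newborn {main} {e} M k n) i ≡ (start , k + i , M + (k + i))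
  newborn-at M k (suc n) zero    _         =
    cong (λ j → start , j , M + j) (sym (+-identityʳ k))
  newborn-at M k (suc n) (suc i) (s≤s i<n) =
    trans (newborn-at M (suc k) n i i<n) (cong (λ j → start , j , M + j) (sym (+-suc k i)))

  newborn-initial : ∀ n → Initial (Fin (suc n)) (config {main} {e} (newborn {main} {e} (suc n) 0 (suc n)))
  newborn-initial n = record
    { state    = λ a → trans (cong (proj₁ ∘ local {main} {e}) (entry a)) (sym (q₀-clamped {main} {e}))
    ; distinct = λ a i a′ i′ apart eq →
        separate a i a′ i′ apart (trans (sym (regs a i)) (trans eq (regs a′ i′))) }
    where
    γ : Config (Fin (suc n))
    γ = config {main} {e} (newborn {main} {e} (suc n) 0 (suc n))
    entry : ∀ (a : Fin (suc n)) → at-index {main} {e} (newborn {main} {e} (suc n) 0 (suc n)) (toℕ a) ≡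
                               (start , toℕ a , suc n + toℕ a)
    entry a = newborn-at (suc n) 0 (suc n) (toℕ a) (toℕ<n a)
    value : Fin (suc n) → Fin 2 → ℕ
    value a own  = toℕ a
    value a link = suc n + toℕ a
    regs : ∀ a i → reg (Fin (suc n)) γ a i ≡ value a i
    regs a own  = cong (λ x → lookup (proj₂ (local {main} {e} x)) own) (entry a)
    regs a link = cong (λ x → lookup (proj₂ (local {main} {e} x)) link) (entry a)
    separate : ∀ a i a′ i′ → (a , i) ≢ (a′ , i′) → value a i ≢ value a′ i′
    separate a own  a′ own  apart eq = apart (cong (_, own) (toℕ-injective eq))
    separate a own  a′ link apart eq = <⇒≢ (≤-trans (toℕ<n a) (m≤m+n (suc n) (toℕ a′))) eq
    separate a link a′ own  apart eq = <⇒≢ (≤-trans (toℕ<n a′) (m≤m+n (suc n) (toℕ a))) (sym eq)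
    separate a link a′ link apart eq =
      apart (cong (_, link) (toℕ-injective (+-cancelˡ-≡ (suc n) (toℕ a) (toℕ a′) eq)))

  gone-final : ∀ k X i → proj₁ (at-index {main} {e} (gone {main} {e} k X) i) ≡ ctl (run end)
  gone-final k []      i       = refl
  gone-final k (x ∷ X) zero    = refl
  gone-final k (x ∷ X) (suc i) = gone-final (suc k) X i

  ends⇒target : ∀ {τ} → Star (Move instr) (load e , λ _ → 0) (run end , τ) → Target (P , qf)
  ends⇒target ms =
    -- One root and `suc n` cells: a blank cell for each of the `n` moves, and a further one that
    -- makes the row nonempty by form, as linking needs a first cell.
    let M = 2 + n
        linking = sending⇒step {main} {e} (cong (2 +_) (newborn-length M 2 n))
                    (here start∈ (head (hears ↓ (cell-link∈ {main} {e}) refl)))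
        initialising = proj₁ (cell-steps⇒run {main} {e} (cong suc (newborn-length M 2 n))
                                (init-cells {main} {e} M 0 n refl))
        Y , simulating , len , Y∈ =
          simulate {N = n} {X = replicate (suc n) 0} ms (load ≤-refl)
            (length-replicate (suc n) , All.replicate⁺ (suc n) (here refl))
            (represents-blank (suc n))
            (≤-trans (n≤1+n n) (≤-reflexive (sym (count-replicate 0 (suc n)))))
        leaving = proj₁ (cell-steps⇒run {main} {e} (trans (cells-length 0 Y) len)
                           (leave-cells {main} {e} Y∈))
    in suc n , _ , _ , newborn-initial (suc n) ,
       (linking ◅ initialising ◅◅ simulating ◅◅ leaving) ,
       λ { zero → refl ; (suc a) → cong (clampSt) (gone-final 0 Y (toℕ a)) }
    where
    n : ℕ
    n = moves ms

-- The diagonal argument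

module _ (main : Prog) (e : ℕ) where
  open Network main e

  lift-run : ∀ {p q σ τ} → Star (Move progInstr) (p , σ) (q , τ) →
             Star (Move instr) (run p , σ) (run q , τ)
  lift-run = gmap (λ (p , σ) → run p , σ) lift
    where
    lift : ∀ {pσ qτ} → Move progInstr pσ qτ →
           Move instr (run (proj₁ pσ) , proj₂ pσ) (run (proj₁ qτ) , proj₂ qτ)
    lift (incr eq τr τq) = incr (cong (Maybe.map (mapInstr run)) eq) τr τq
    lift (decr eq σr τq) = decr (cong (Maybe.map (mapInstr run)) eq) σr τq
    lift (none eq σr τq) = none (cong (Maybe.map (mapInstr run)) eq) σr τq

  loads : ∀ j σ → ∃[ τ ] Star (Move instr) (load j , σ) (run main , τ) ×
                  τ 0 ≡ j + σ 0 × (∀ q → 2 ≤ q → τ q ≡ σ q)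
  loads zero    σ =
    σ [ 1 ≔ suc (σ 1) ] , incr refl refl (≔-other σ 1 _) ◅ ε , refl ,
    λ q 2≤q → ≔-other σ 1 _ q (>⇒≢ 2≤q)
  loads (suc j) σ =
    let τ , ms , τ0 , τq = loads j (σ [ 0 ≔ suc (σ 0) ]) in
    τ , incr refl refl (≔-other σ 0 _) ◅ ms , trans τ0 (+-suc j (σ 0)) ,
    λ q 2≤q → trans (τq q 2≤q) (≔-other σ 0 _ q (>⇒≢ (≤-trans (s≤s z≤n) 2≤q)))

opaque

  evaluate : Rec 1 → Prog
  -- Register 0 holds the argument and register 1 the unit left by the loader, so the output is
  -- register 2 and scratch space starts at 3.
  evaluate f = compile f (λ _ → 0) 2 3

  evaluate-ends : ∀ f {x y σ} → f [ x ∷ [] ]⇓ y → σ 0 ≡ x → (∀ q → 2 ≤ q → σ q ≡ 0) →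
                  Ends (evaluate f) σ (Sets σ 2 y)
  evaluate-ends f d σ0 clean = compile-correct f d record
    { out<free = ≤-refl
    ; ins<free = λ _ → s≤s z≤n
    ; ins≢out  = λ _ ()
    ; args     = λ { zero → σ0 }
    ; blank    = clean 2 ≤-refl
    ; clean    = λ q 3≤q → clean q (≤-trans (n≤1+n 2) 3≤q)
    }

-- Halts at end if f maps the code of the self-referential instance to 0, and
-- gets stuck if it maps it to a positive number.
opaque

  diagonal : Rec 1 → Prog
  diagonal f = evaluate (comp f (selfRec ∷ [])) ▷ loop 2 stuck end

  diagonal-def : ∀ f → diagonal f ≡ evaluate (comp f (selfRec ∷ [])) ▷ loop 2 stuck end
  diagonal-def f = refl

diagonal-evaluates : ∀ f {y} → let main = diagonal f in f [ code (self main) ∷ [] ]⇓ y →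
  ∃[ τ ] Star (Move (Fixed.instr main)) (load (codeFixed main) , λ _ → 0)
              (run (loop 2 stuck end) , τ) × τ 2 ≡ y
diagonal-evaluates f d =
  let main = diagonal f
      e = codeFixed main
      τ , ms , τ0 , τq = loads main e e (λ _ → 0)
      υ , ps , υ2 , _ = evaluate-ends (comp f (selfRec ∷ [])) (comp⇓ (selfRec-computes main ∷ []) d)
                          (trans τ0 (+-identityʳ e)) τq
  in υ ,
     ms ◅◅ lift-run main e (subst (λ p → Star (Move progInstr) (p , τ) (loop 2 stuck end , υ))
             (sym (diagonal-def f)) (ps (loop 2 stuck end))) ,
     υ2

-- First `Target` is refuted: it would make the program get stuck by the verdict of `f` and halt by
-- soundness, against determinism. Then `f` must reject, so the program halts and completeness
-- yields `Target`. No case distinction on `Target` is made.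
target-undecidable : Undecidable {Instance 2} code Target
target-undecidable (f , decides) = ¬target (ends⇒target {main} {e} accepted)
  where
  open Decides decides
  main : Prog
  main = diagonal f
  e : ℕ
  e = codeFixed main
  ¬target : ¬ Target (self main)
  ¬target t =
    let τ , ms , τ2 = diagonal-evaluates f (accepts (self main) t)
        σ , ms′ = target⇒ends {main} {e} t
    in end≢stuck (run-deterministic (λ _ → refl) refl refl ms′
         -- The verdict 1 in register 2 is decremented on entering the loop, whose body is `stuck`.
         (ms ◅◅ decr {c′ = run stuck} {τ = τ [ 2 ≔ 0 ]} refl τ2 (≔-other τ 2 0) ◅ ε))
    where
    end≢stuck : run end ≢ run stuck
    end≢stuck ()
  accepted : Star (Move (Fixed.instr main)) (load e , λ _ → 0) (run end , _)
  accepted =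
    let τ , ms , τ2 = diagonal-evaluates f (rejects (self main) ¬target)
    in ms ◅◅ lift-run main e (loop-exit end τ2)

-- An instance with two registers has the same code among all instances, so a decider for arbitrary
-- numbers of registers would also serve for two.
proposition29 : Undecidable {Σ ℕ Instance} (λ I → code (proj₂ I)) (λ I → Target (proj₂ I))
    × Undecidable {Instance 2} code Target
proposition29 =
  (λ (f , decides) → target-undecidable (f , record
    { accepts = λ I → Decides.accepts decides (2 , I)
    ; rejects = λ I → Decides.rejects decides (2 , I) })) ,
  target-undecidable
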